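{- Let $M$ be a standard multigraph on $n$ vertices with $\delta(M)\geq\frac{4n-3}{3}$. Then $M$ has a tiling consisting of $\left\lfloor\frac{n}{3}\right\rfloor$ tiles, one of which is a $4$-triangle and the remaining $\left\lfloor\frac{n}{3}\right\rfloor-1$ of which are $5$-triangles.
   Context: Multigraphs have no loops. For vertices $x,y$ of a multigraph $M$, $\mu(x,y)$ denotes the number of edges with ends $x$ and $y$ (so $\mu(x,y)=0$ if $x,y$ are nonadjacent). $M$ is standard if $\mu(x,y)\le 2$ for all $x,y$. The degree of $x$ is $d(x)=\sum_{y}\mu(x,y)$ and $\delta(M)=\min_x d(x)$. For $k\in\{3,4,5,6\}$, a $k$-triangle is a multigraph on exactly three vertices that contains a (simple) triangle $C_3$ and has exactly $k$ edges (counted with multiplicity). A tiling of $M$ is a set of pairwise vertex-disjoint sub-multigraphs of $M$ (tiles); thus a tile that is a $k$-triangle exists on three vertices $x,y,z$ exactly when $x,y,z$ are pairwise adjacent and $\mu(x,y)+\mu(y,z)+\mu(x,z)\ge k$.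
   Formalization: The formal theorem assumes n ≥ 3; for n = 2 (two vertices joined by a double edge) the degree condition holds but there are 0 tiles, so none can be a 4-triangle, and n = 0 fails likewise. -}

module Defs where

open import Data.Nat using (ℕ; zero; suc; _+_; _*_; _≤_; _<_; _/_)
open import Data.Fin using (Fin)
open import Data.Product using (_×_; Σ; ∃)
open import Relation.Binary.PropositionalEquality using (_≡_)

record Multigraph (n : ℕ) : Set where
  field
    μ     : Fin n → Fin n → ℕ
    sym   : ∀ x y → μ x y ≡ μ y x
    loopless : ∀ x → μ x x ≡ 0

open Multigraph public

Standard : ∀ {n} → Multigraph n → Set
Standard M = ∀ x y → μ M x y ≤ 2

∑ : ∀ n → (Fin n → ℕ) → ℕ
∑ zero    f = 0
∑ (suc n) f = f Fin.zero + ∑ n (λ i → f (Fin.suc i))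

deg : ∀ {n} → Multigraph n → Fin n → ℕ
deg {n} M x = ∑ n (λ y → μ M x y)

-- δ(M) ≥ (4n-3)/3, written without division: 3·d(x) + 3 ≥ 4n for every x
MinDegreeCond : ∀ {n} → Multigraph n → Set
MinDegreeCond {n} M = ∀ x → 4 * n ≤ 3 * deg M x + 3

-- three vertices x,y,z carry a k-triangle (as a sub-multigraph):
-- pairwise adjacent and μ(x,y)+μ(y,z)+μ(x,z) ≥ k
HasKTriangle : ∀ {n} → Multigraph n → ℕ → Fin n → Fin n → Fin n → Set
HasKTriangle M k x y z =
  (1 ≤ μ M x y) × (1 ≤ μ M y z) × (1 ≤ μ M x z) ×
  (k ≤ μ M x y + μ M y z + μ M x z)

record TriangleTiling {n} (M : Multigraph n) (t : ℕ) : Set where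
  field
    v        : Fin t → Fin 3 → Fin n
    disjoint : ∀ i j i' j' → v i j ≡ v i' j' → (i ≡ i') × (j ≡ j')

TileIsK : ∀ {n} {M : Multigraph n} {t} → TriangleTiling M t → Fin t → ℕ → Set
TileIsK {M = M} T i k =
  HasKTriangle M k (TriangleTiling.v T i Fin.zero)
                   (TriangleTiling.v T i (Fin.suc Fin.zero))
                   (TriangleTiling.v T i (Fin.suc (Fin.suc Fin.zero)))

GoodTiling : ∀ {n} → Multigraph n → Set
GoodTiling {n} M =
  Σ (TriangleTiling M (n / 3)) λ T →
  Σ (Fin (n / 3)) λ i₀ →
    TileIsK T i₀ 4 × (∀ i → ¬≡ i i₀ → TileIsK T i 5)
  where
    open import Relation.Nullary using (¬_)
    ¬≡ : Fin (n / 3) → Fin (n / 3) → Set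
    ¬≡ a b = ¬ (a ≡ b)

{-# OPTIONS --safe #-}
module Submission where

{-
Write a tile as a triple and call it deficient when its weight (the sum of its
three multiplicities) is below 5; in a standard multigraph a tile of weight at
least 5 is a 5-triangle.  If n ≡ 1 (mod 3), delete a vertex; if n ≡ 2,
add a vertex joined doubly to everything and discard its tile in the end.  So let
n = 3k; then every degree is at least 4k − 1.

Saturate the pairs inside some partition into k triples, edge by edge.  The
saturated multigraph is tiled by that partition, so it is enough to pass from a
good tiling of M + e to one of M.  Dropping e damages one tile only: either a
single deficient tile X remains, or two tiles X, Y of weight at least 4.

One deficient tile.  Its weight is at most 4, so by degree counting some other
tile U receives at least 13 edges from X.  A finite check shows that X ∪ U can be
regrouped into a 5-triangle and a heavier X, until X is a 4-triangle or a double
path x–y–z with x, z nonadjacent.  For such a path, counting the edges at x and z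
gives a tile U with at least 9 of them, and unless X ∪ U regroups, y misses U
and x, z can be attached to U (a "hinge") so that y forms double paths with a
vertex k of U as well.  Counting the edges at x, y, z and k again then produces a
second tile which resolves one of these paths.

Two deficient tiles.  Some tile U receives at least 25 edges from X ∪ Y.  Either
X ∪ Y ∪ U contains two disjoint 5-triangles, which leaves one deficient tile, or
U can be exchanged for a 6-triangle, which can happen only finitely often.
-}

open import Defs renaming (sym to μ-sym)
open import Data.Bool using (Bool; true; false; T; _∧_; _∨_)
open import Data.Bool.Properties using (T-∧; T-∨)
open import Data.Fin as Fin using (Fin; zero; suc)
open import Data.Fin.Patterns using (0F; 1F; 2F)
import Data.Fin.Properties as Fin
open import Data.List using (List; []; _∷_; _++_; map; length; upTo; allFin; tabulate; lookup)
open import Data.List.Membership.DecPropositional using (_∈?_)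
open import Data.List.Membership.Propositional.Properties using (∈-∃++; ∈-lookup)
open import Data.List.Properties using (length-++; length-map; length-tabulate; map-tabulate)
open import Data.List.Relation.Binary.Permutation.Propositional
  using (_↭_; refl; prep; swap; trans; ↭-refl; ↭-sym; ↭-swap; ↭-prep; ↭-trans; ↭⇒↭ₛ)
open import Data.List.Relation.Binary.Permutation.Propositional.Properties
  using (shift; shifts; map⁺; ++⁺ˡ; ++⁺ʳ; ++⁺; All-resp-↭; ↭-length)
import Data.List.Relation.Binary.Permutation.Setoid.Properties as Permutationₛ
open import Data.List.Relation.Unary.All as All using (All; []; _∷_; all?)
import Data.List.Relation.Unary.All.Properties as All
open import Data.List.Relation.Unary.AllPairs using ([]; _∷_)
open import Data.List.Relation.Unary.Unique.Propositional using (Unique)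
import Data.List.Relation.Unary.Unique.Propositional.Properties as Unique
open import Data.Maybe using (Maybe; just; nothing; is-just)
open import Data.Nat
open import Data.Nat.DivMod using (m≡m%n+[m/n]*n; m%n<n; m≥n⇒m/n>0)
open import Data.Nat.ListAction using (sum)
open import Data.Nat.ListAction.Properties using (sum-↭)
open import Data.Nat.Properties
open import Data.Nat.Tactic.RingSolver using (solve-∀)
open import Data.Product using (Σ; ∃; ∃₂; _×_; _,_; proj₁; proj₂)
open import Data.Sum as Sum using (_⊎_; inj₁; inj₂; [_,_])
open import Data.Unit using (tt)
open import Data.Vec using (Vec; []; _∷_)
open import Function using (Equivalence; _∘_)
open import Relation.Binary.PropositionalEquality
  using (_≡_; _≢_; refl; cong; cong₂; subst; subst₂; setoid; ≢-sym)
  renaming (sym to ≡-sym; trans to ≡-trans)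
open import Relation.Nullary using (Dec; yes; no; ¬_; ¬?; _×-dec_; _⊎-dec_; contradiction)

-- Boolean tests on the edges between two tiles

Mat : Set
Mat = Fin 3 → Fin 3 → ℕ

-- Lower bounds for the multiplicities inside a tile.  All tests below are monotone and
-- look only at entries above the diagonal, so the remaining entries may be 0.
upper : ℕ → ℕ → ℕ → Mat
upper p q r 0F 1F = p
upper p q r 0F 2F = q
upper p q r 1F 2F = r
upper p q r _  _  = 0

rows : (a b c d e f g h i : ℕ) → Mat
rows a b c d e f g h i 0F 0F = a
rows a b c d e f g h i 0F 1F = b
rows a b c d e f g h i 0F 2F = c
rows a b c d e f g h i 1F 0F = d
rows a b c d e f g h i 1F 1F = e
rows a b c d e f g h i 1F 2F = f
rows a b c d e f g h i 2F 0F = g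
rows a b c d e f g h i 2F 1F = h
rows a b c d e f g h i 2F 2F = i

rowSum : Mat → Fin 3 → ℕ
rowSum c i = c i 0F + c i 1F + c i 2F

total : Mat → ℕ
total c = rowSum c 0F + rowSum c 1F + rowSum c 2F

all3 : (ℕ → Bool) → Bool
all3 P = P 0 ∧ P 1 ∧ P 2

allMat : (Mat → Bool) → Bool
allMat P = all3 λ a → all3 λ b → all3 λ c → all3 λ d → all3 λ e → all3 λ f →
           all3 λ g → all3 λ h → all3 λ i → P (rows a b c d e f g h i)

-- The two entries not singled out stay in increasing order, so a pair inside a tile is always read
-- above the diagonal.
anyPick : ∀ {A : Set} (x y z : A) → (A → A → A → Bool) → Bool
anyPick x y z f = f x y z ∨ f y x z ∨ f z x y

data Cond : Set where
  wt tri : ℕ → Cond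

test : Cond → ℕ → ℕ → ℕ → Bool
test (wt k)  a b c = k ≤ᵇ a + b + c
test (tri k) a b c = (k ≤ᵇ a + b + c) ∧ (0 <ᵇ a) ∧ (0 <ᵇ b) ∧ (0 <ᵇ c)

-- Only the regroupings that trade one vertex `l` of X for one vertex `k` of U are tried.
splitTest : Cond → Cond → Mat → Mat → Mat → Bool
splitTest C D xs ts c =
  anyPick 0F 1F 2F λ l i j → anyPick 0F 1F 2F λ k p q →
    (test C (xs i j) (c j k) (c i k) ∧ test D (c l p) (ts p q) (c l q)) ∨
    (test D (xs i j) (c j k) (c i k) ∧ test C (c l p) (ts p q) (c l q))

-- The edges between X and U are summarised by six bits: `attached k` says that U's vertex k
-- forms a 5-triangle with a pair of X, `covered p q` that U's pair p, q does with a vertex of X.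
attached : Mat → Mat → Fin 3 → Bool
attached xs c k = anyPick 0F 1F 2F λ l i j → 5 ≤ᵇ xs i j + c j k + c i k

absorbs : Mat → Mat → Fin 3 → Fin 3 → Fin 3 → Bool
absorbs ts c l p q = 5 ≤ᵇ c l p + ts p q + c l q

covered : Mat → Mat → Fin 3 → Fin 3 → Bool
covered ts c p q = anyPick 0F 1F 2F λ l i j → absorbs ts c l p q

one : Bool → ℕ
one true  = 1
one false = 0

-- An upper bound for the number of edges between X and U in terms of the six bits, valid
-- when no regrouping of X ∪ U helps; d₀, d₁, d₂ are indexed by the vertex of U left out.
-- Bits of two tiles X, Y that yield no two disjoint 5-triangles have bounds of sum at most 24.
bound : (s₀ s₁ s₂ d₀ d₁ d₂ : Bool) → ℕ
bound s₀ s₁ s₂ d₀ d₁ d₂ = by (one s₀ + one s₁ + one s₂)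
  where
  by : ℕ → ℕ
  by 0 = 9 + (one d₀ + one d₁ + one d₂)
  by 1 = 12
  by 2 = 14
  by _ = 15

codeBound : Mat → Mat → Mat → ℕ
codeBound xs ts c =
  bound (attached xs c 0F) (attached xs c 1F) (attached xs c 2F)
    (covered ts c 1F 2F) (covered ts c 0F 2F) (covered ts c 0F 1F)

hingeAt lightHingeAt : Mat → Mat → (i j k p q : Fin 3) → Bool
hingeAt      ts c i j k p q = absorbs ts c i p q ∧ (2 ≤ᵇ c j k)
lightHingeAt ts c i j k p q =
  absorbs ts c i p q ∧ (test (tri 4) (c j p) (ts p q) (c j q) ∧ ((1 ≤ᵇ c j k) ∧ (2 ≤ᵇ c i k)))

doubleHingeAt : Mat → Mat → (k p q : Fin 3) → Bool
doubleHingeAt ts c k p q =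
  absorbs ts c 1F p q ∧ (absorbs ts c 2F p q ∧ ((2 ≤ᵇ c 1F k) ∧ (2 ≤ᵇ c 2F k)))

doubleHinge : Mat → Mat → Bool
doubleHinge ts c = anyPick 0F 1F 2F (doubleHingeAt ts c)

hinges : Mat → Mat → Fin 3 → Fin 3 → Bool
hinges ts c i j = anyPick 0F 1F 2F (hingeAt ts c i j) ∨ anyPick 0F 1F 2F (lightHingeAt ts c i j)

-- Finite checks by evaluation

Holds : Bool → Set
Holds b = b ≡ true

-- A data type and not a synonym: `P` can be read off from the type without unfolding the 3^9 cases.
data ForAllMat (P : Mat → Bool) : Set where
  forAllMat : Holds (allMat P) → ForAllMat P

-- Raises a deficient tile of any weight to weight 3; `check-210` and `check-111` then raise weight
-- 3 to weight 4.
check-any : ForAllMat (λ c →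
  (total c ≤ᵇ 12) ∨ splitTest (wt 5) (wt 3) (upper 0 0 0) (upper 2 2 1) c)
check-any = forAllMat refl

check-210 : ForAllMat (λ c →
  (total c ≤ᵇ 12) ∨ splitTest (wt 5) (wt 4) (upper 2 1 0) (upper 2 2 1) c)
check-210 = forAllMat refl

check-111 : ForAllMat (λ c →
  (total c ≤ᵇ 12) ∨ splitTest (wt 5) (wt 4) (upper 1 1 1) (upper 2 2 1) c)
check-111 = forAllMat refl

-- For two deficient tiles: more than 12 edges between them already give a 5-triangle, and `wt 0`
-- asks nothing of the tile left over.
check-any-211 : ForAllMat (λ c →
  (total c ≤ᵇ 12) ∨ splitTest (wt 5) (wt 0) (upper 0 0 0) (upper 2 1 1) c)
check-any-211 = forAllMat refl

check-any-220 : ForAllMat (λ c →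
  (total c ≤ᵇ 12) ∨ splitTest (wt 5) (wt 0) (upper 0 0 0) (upper 2 2 0) c)
check-any-220 = forAllMat refl

-- Row 0 belongs to the centre y of a double path, rows 1 and 2 to its ends. When no regrouping
-- helps, y misses U and the ends are hinged to U.
check-220 : ForAllMat (λ c →
  (rowSum c 1F + rowSum c 2F ≤ᵇ 8) ∨
  (splitTest (wt 5) (tri 4) (upper 2 2 0) (upper 2 2 1) c ∨
  ((rowSum c 0F ≤ᵇ 0) ∧
   (doubleHinge (upper 2 2 1) c ∨
   ((rowSum c 1F + rowSum c 2F ≤ᵇ 10) ∧
     (hinges (upper 2 2 1) c 2F 1F ∨ hinges (upper 2 2 1) c 1F 2F))))))
check-220 = forAllMat refl

-- For the path left by a light hinge: its centre has one double and one possibly simple edge. If no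
-- regrouping helps, the centre is almost cut off from U.
check-path : ForAllMat (λ c →
  (rowSum c 1F + rowSum c 2F ≤ᵇ 8) ∨
  (splitTest (wt 5) (tri 4) (upper 2 1 0) (upper 2 2 1) c ∨ (rowSum c 0F ≤ᵇ 1)))
check-path = forAllMat refl

check-full : ForAllMat (λ c →
  (total c ≤ᵇ 15) ∨ splitTest (wt 5) (wt 5) (upper 2 2 0) (upper 2 2 1) c)
check-full = forAllMat refl

codeTest221 codeTest222 : Mat → Mat → Bool
codeTest221 xs c =
  splitTest (wt 5) (wt 5) xs (upper 2 2 1) c ∨ (splitTest (wt 6) (wt 4) xs (upper 2 2 1) c ∨
  (total c ≤ᵇ codeBound xs (upper 2 2 1) c))
codeTest222 xs c =
  splitTest (wt 5) (wt 5) xs (upper 2 2 2) c ∨ (total c ≤ᵇ codeBound xs (upper 2 2 2) c)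

check-211-221 : ForAllMat (codeTest221 (upper 2 1 1))
check-211-221 = forAllMat refl

check-220-221 : ForAllMat (codeTest221 (upper 2 2 0))
check-220-221 = forAllMat refl

check-211-222 : ForAllMat (codeTest222 (upper 2 1 1))
check-211-222 = forAllMat refl

check-220-222 : ForAllMat (codeTest222 (upper 2 2 0))
check-220-222 = forAllMat refl

-- Primed bits belong to Y. The leading `s` and `d` of each tile concern one vertex of U and the
-- pair p, q opposite to it. A true value exhibits two disjoint 5-triangles.
meet : (s d s′ d′ sₚ′ s_q′ : Bool) → Bool
meet s d s′ d′ sₚ′ s_q′ = (s ∧ (d′ ∨ (sₚ′ ∨ s_q′))) ∨ (d ∧ s′)

compatible : (s₀ s₁ s₂ d₀ d₁ d₂ s₀′ s₁′ s₂′ d₀′ d₁′ d₂′ : Bool) → Bool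
compatible s₀ s₁ s₂ d₀ d₁ d₂ s₀′ s₁′ s₂′ d₀′ d₁′ d₂′ =
  meet s₀ d₀ s₀′ d₀′ s₁′ s₂′ ∨ (meet s₁ d₁ s₁′ d₁′ s₀′ s₂′ ∨ meet s₂ d₂ s₂′ d₂′ s₀′ s₁′)

allBits : ∀ n → (Vec Bool n → Bool) → Bool
allBits zero    P = P []
allBits (suc n) P = allBits n (λ v → P (true ∷ v)) ∧ allBits n (λ v → P (false ∷ v))

codesMeet : Vec Bool 12 → Bool
codesMeet (s₀ ∷ s₁ ∷ s₂ ∷ d₀ ∷ d₁ ∷ d₂ ∷ s₀′ ∷ s₁′ ∷ s₂′ ∷ d₀′ ∷ d₁′ ∷ d₂′ ∷ []) =
  (bound s₀ s₁ s₂ d₀ d₁ d₂ + bound s₀′ s₁′ s₂′ d₀′ d₁′ d₂′ ≤ᵇ 24) ∨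
  compatible s₀ s₁ s₂ d₀ d₁ d₂ s₀′ s₁′ s₂′ d₀′ d₁′ d₂′

check-codes : Holds (allBits 12 codesMeet)
check-codes = refl

symm : ℕ → ℕ → ℕ → Mat
symm p q r 0F 1F = p
symm p q r 1F 0F = p
symm p q r 0F 2F = q
symm p q r 2F 0F = q
symm p q r 1F 2F = r
symm p q r 2F 1F = r
symm p q r _  _  = 0

atLeast : Mat → ℕ → ℕ → ℕ → Fin 3 → Fin 3 → Fin 3 → Bool
atLeast m p q r i j k = (p ≤ᵇ m i j) ∧ ((q ≤ᵇ m i k) ∧ (r ≤ᵇ m j k))

shape : Mat → ℕ → ℕ → ℕ → Bool
shape m p q r = anyPick 0F 1F 2F λ i j k → atLeast m p q r i j k ∨ atLeast m p q r i k j

-- The sum `p + r + q` follows the order of the summands in `w`, whose middle term is the pair that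
-- misses the first vertex.
shapes : (ℕ → Mat → Bool) → Bool
shapes P = all3 λ p → all3 λ q → all3 λ r → P (p + r + q) (symm p q r)

check-five : Holds (shapes λ w m → (w ≤ᵇ 4) ∨ shape m 2 2 1)
check-five = refl

check-six : Holds (shapes λ w m → (w ≤ᵇ 5) ∨ atLeast m 2 2 2 0F 1F 2F)
check-six = refl

check-four : Holds (shapes λ w m → (w ≤ᵇ 3) ∨ (shape m 2 1 1 ∨ shape m 2 2 0))
check-four = refl

check-three : Holds (shapes λ w m → (w ≤ᵇ 2) ∨ (shape m 1 1 1 ∨ shape m 2 1 0))
check-three = refl

-- From Boolean checks to propositions

T-all3 : ∀ {P m} → T (all3 P) → m ≤ 2 → T (P m)
T-all3 {P} h z≤n             = proj₁ (T-∧ .Equivalence.to h)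
T-all3 {P} h (s≤s z≤n)       = proj₁ (T-∧ .Equivalence.to (proj₂ (T-∧ {P 0} .Equivalence.to h)))
T-all3 {P} h (s≤s (s≤s z≤n)) = proj₂ (T-∧ {P 1} .Equivalence.to (proj₂ (T-∧ {P 0} .Equivalence.to h)))

T-or : ∀ {a b} → T (a ∨ b) → T a ⊎ T b
T-or = T-∨ .Equivalence.to

T-and : ∀ {a b} → T (a ∧ b) → T a × T b
T-and = T-∧ .Equivalence.to

T-anyPick : ∀ {A : Set} {x y z : A} {f} → T (anyPick x y z f) →
  ∃ λ i → ∃ λ j → ∃ λ k → (i ∷ j ∷ k ∷ [] ↭ x ∷ y ∷ z ∷ []) × T (f i j k)
T-anyPick {x = x} {y} {z} {f} h with T-or {f x y z} h
... | inj₁ p = x , y , z , ↭-refl , p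
... | inj₂ h with T-or {f y x z} h
...   | inj₁ p = y , x , z , ↭-swap y x ↭-refl , p
...   | inj₂ p = z , x , y , ↭-sym (shift z (x ∷ y ∷ []) []) , p

check≤ : ∀ {P} {b} m → T ((P ≤ᵇ m) ∨ b) → m < P → T b
check≤ {P} m h m<P with T-or {P ≤ᵇ m} h
... | inj₁ p = contradiction (≤ᵇ⇒≤ P m p) (<⇒≱ m<P)
... | inj₂ q = q

holds : ∀ {b} → Holds b → T b
holds refl = tt

opaque
  T-allMat : ∀ {P} → ForAllMat P → ∀ {a b c d e f g h i} →
    a ≤ 2 → b ≤ 2 → c ≤ 2 → d ≤ 2 → e ≤ 2 → f ≤ 2 → g ≤ 2 → h ≤ 2 → i ≤ 2 →
    T (P (rows a b c d e f g h i))
  T-allMat {P} (forAllMat H) {a} {b} {c} {d} {e} {f} {g} {h} {i} a≤ b≤ c≤ d≤ e≤ f≤ g≤ h≤ i≤ =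
    T-all3 {λ i → P (rows a b c d e f g h i)}
      (T-all3 {λ h → all3 λ i → P (rows a b c d e f g h i)}
      (T-all3 {λ g → all3 λ h → all3 λ i → P (rows a b c d e f g h i)}
      (T-all3 {λ f → all3 λ g → all3 λ h → all3 λ i → P (rows a b c d e f g h i)}
      (T-all3 {λ e → all3 λ f → all3 λ g → all3 λ h → all3 λ i → P (rows a b c d e f g h i)}
      (T-all3 {λ d → all3 λ e → all3 λ f → all3 λ g → all3 λ h → all3 λ i →
         P (rows a b c d e f g h i)}
      (T-all3 {λ c → all3 λ d → all3 λ e → all3 λ f → all3 λ g → all3 λ h → all3 λ i →
         P (rows a b c d e f g h i)}
      (T-all3 {λ b → all3 λ c → all3 λ d → all3 λ e → all3 λ f → all3 λ g → all3 λ h → all3 λ i →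
         P (rows a b c d e f g h i)}
      (T-all3 {λ a → all3 λ b → all3 λ c → all3 λ d → all3 λ e → all3 λ f → all3 λ g → all3 λ h →
         all3 λ i → P (rows a b c d e f g h i)}
      (holds H) a≤) b≤) c≤) d≤) e≤) f≤) g≤) h≤) i≤

opaque
  T-shapes : ∀ {P} → Holds (shapes P) → ∀ {p q r} → p ≤ 2 → q ≤ 2 → r ≤ 2 → T (P (p + r + q) (symm p q r))
  T-shapes {P} H {p} {q} {r} p≤ q≤ r≤ =
    T-all3 {λ r → P (p + r + q) (symm p q r)}
      (T-all3 {λ q → all3 λ r → P (p + r + q) (symm p q r)}
      (T-all3 {λ p → all3 λ q → all3 λ r → P (p + r + q) (symm p q r)} (holds H) p≤) q≤) r≤

opaque
  T-allBits : ∀ n {P} → T (allBits n P) → ∀ v → T (P v)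
  T-allBits zero    h []          = h
  T-allBits (suc n) {P} h (true ∷ v)  = T-allBits n {λ v → P (true ∷ v)} (proj₁ (T-and h)) v
  T-allBits (suc n) {P} h (false ∷ v) =
    T-allBits n {λ v → P (false ∷ v)} (proj₂ (T-and {allBits n (λ v → P (true ∷ v))} h)) v

-- Permutations given by positions

permutation? : (is js : List ℕ) → Maybe (is ↭ js)
permutation? []       []      = just refl
permutation? []       (_ ∷ _) = nothing
permutation? (i ∷ is) js with _∈?_ _≟_ i js
... | no _  = nothing
... | yes p with ∈-∃++ p
...   | as , bs , refl with permutation? is (as ++ bs)
...     | nothing = nothing
...     | just q  = just (↭-trans (↭-prep i q) (↭-sym (shift i as bs)))

nth : ∀ {A : Set} → A → List A → ℕ → A
nth d []       _       = d
nth d (x ∷ xs) zero    = x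
nth d (x ∷ xs) (suc i) = nth d xs i

-- Reduces a reordering of named vertices to one of positions, which is found by evaluation. The
-- default `d` is never reached, because `is` permutes the valid positions.
rearrange : ∀ {A : Set} (d : A) (xs : List A) (is : List ℕ) →
  {T (is-just (permutation? is (upTo (length xs))))} →
  ∀ {zs} → map (nth d xs) is ++ zs ↭ map (nth d xs) (upTo (length xs)) ++ zs
rearrange d xs is {h} {zs} with permutation? is (upTo (length xs))
... | just p = ++⁺ʳ zs (map⁺ (nth d xs) p)


-- Tiles as triples, and counting over a list of tiles

Triple : Set → Set
Triple A = A × A × A

verts : ∀ {A : Set} → Triple A → List A
verts (a , b , c) = a ∷ b ∷ c ∷ []

flat : ∀ {A : Set} → List (Triple A) → List A
flat []       = []
flat (t ∷ ts) = verts t ++ flat ts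

flat-↭ : ∀ {A : Set} {ts us : List (Triple A)} → ts ↭ us → flat ts ↭ flat us
flat-↭ refl         = refl
flat-↭ (prep t p)   = ++⁺ˡ (verts t) (flat-↭ p)
flat-↭ (swap t u p) = ↭-trans (shifts (verts t) (verts u)) (++⁺ˡ (verts u) (++⁺ˡ (verts t) (flat-↭ p)))
flat-↭ (trans p q)  = ↭-trans (flat-↭ p) (flat-↭ q)

flat-++ : ∀ {A : Set} (ts us : List (Triple A)) → flat (ts ++ us) ≡ flat ts ++ flat us
flat-++ []       us = refl
flat-++ (t ∷ ts) us = cong (verts t ++_) (flat-++ ts us)

length-flat : ∀ {A : Set} (ts : List (Triple A)) → length (flat ts) ≡ 3 * length ts
length-flat []       = refl
length-flat (t ∷ ts) = ≡-trans (cong (3 +_) (length-flat ts)) (≡-sym (*-suc 3 (length ts)))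

at : ∀ {A : Set} → Triple A → Fin 3 → A
at (a , b , c) 0F = a
at (a , b , c) 1F = b
at (a , b , c) 2F = c

pigeonhole : ∀ {A : Set} (f : A → ℕ) c ts → c * length ts < sum (map f ts) →
  ∃₂ λ t us → (ts ↭ t ∷ us) × c < f t
pigeonhole f c (t ∷ ts) h with c <? f t
... | yes p = t , ts , ↭-refl , p
... | no ¬p with pigeonhole f c ts (+-cancelˡ-< c _ _
  (subst (_< c + sum (map f ts)) (*-suc c (length ts)) (<-≤-trans h (+-monoˡ-≤ _ (≮⇒≥ ¬p)))))
...   | u , us , p , q = u , t ∷ us , ↭-trans (↭-prep t p) (↭-swap t u ↭-refl) , q

sum-map-+ : ∀ {A : Set} (f g : A → ℕ) ts →
  sum (map (λ t → f t + g t) ts) ≡ sum (map f ts) + sum (map g ts)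
sum-map-+ f g []       = refl
sum-map-+ f g (t ∷ ts) rewrite sum-map-+ f g ts =
  lemma (f t) (g t) (sum (map f ts)) (sum (map g ts))
  where
  lemma : ∀ a b c d → a + b + (c + d) ≡ a + c + (b + d)
  lemma = solve-∀

-- Weights, edge counts and soundness of the tests

module Weights {n} (M : Multigraph n) (std : Standard M) where

  V Tile : Set
  V = Fin n
  Tile = Triple V

  m : V → V → ℕ
  m = μ M

  w : Tile → ℕ
  w (x , y , z) = m x y + m y z + m x z

  d : V → Tile → ℕ
  d x (a , b , c) = m x a + m x b + m x c

  m-sym : ∀ x y → m x y ≡ m y x
  m-sym = μ-sym M

  m≤2 : ∀ {x y} → m x y ≤ 2
  m≤2 {x} {y} = std x y

  d≤6 : ∀ {x} T → d x T ≤ 6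
  d≤6 T = +-mono-≤ (+-mono-≤ m≤2 m≤2) m≤2

  w≤6 : ∀ T → w T ≤ 6
  w≤6 T = +-mono-≤ (+-mono-≤ m≤2 m≤2) m≤2

  d-sum : ∀ x T → d x T ≡ sum (map (m x) (verts T))
  d-sum x (a , b , c) = lemma (m x a) (m x b) (m x c)
    where
    lemma : ∀ a b c → a + b + c ≡ a + (b + (c + 0))
    lemma = solve-∀

  d-↭ : ∀ {x T U} → verts T ↭ verts U → d x T ≡ d x U
  d-↭ {x} {T} {U} p =
    ≡-trans (d-sum x T) (≡-trans (sum-↭ (map⁺ (m x) p)) (≡-sym (d-sum x U)))

  d-sum-flat : ∀ x ts → sum (map (d x) ts) ≡ sum (map (m x) (flat ts))
  d-sum-flat x []       = refl
  d-sum-flat x (t@(a , b , c) ∷ ts) rewrite d-sum-flat x ts =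
    lemma (m x a) (m x b) (m x c) (sum (map (m x) (flat ts)))
    where
    lemma : ∀ a b c e → a + b + c + e ≡ a + (b + (c + e))
    lemma = solve-∀

  d-self≤4 : ∀ {k p q T} → k ∷ p ∷ q ∷ [] ↭ verts T → d k T ≤ 4
  d-self≤4 {k} {p} {q} {T} e =
    subst (_≤ 4) (d-↭ {U = T} e)
      (subst (λ a → a + m k p + m k q ≤ 4) (≡-sym (loopless M k)) (+-mono-≤ m≤2 m≤2))

  -- The list `us` may repeat a vertex; repetitions act as weights in the degree counts.
  E : List V → Tile → ℕ
  E us T = sum (map (λ u → d u T) us)

  E-↭ : ∀ us {T U} → verts T ↭ verts U → E us T ≡ E us U
  E-↭ []       p = refl
  E-↭ (u ∷ us) {T} {U} p = cong₂ _+_ (d-↭ {u} {T} {U} p) (E-↭ us p)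

  ⟦_⟧ : Cond → Tile → Set
  ⟦ wt k  ⟧ T = k ≤ w T
  ⟦ tri k ⟧ (x , y , z) = HasKTriangle M k x y z

  Five : Tile → Set
  Five = ⟦ wt 5 ⟧

  test-sound : ∀ C {a b c x y z} → T (test C a b c) → a ≤ m x y → b ≤ m y z → c ≤ m x z →
    ⟦ C ⟧ (x , y , z)
  test-sound (wt k) h p q r = ≤-trans (≤ᵇ⇒≤ k _ h) (+-mono-≤ (+-mono-≤ p q) r)
  test-sound (tri k) {a} {b} {c} h p q r with T-and {k ≤ᵇ a + b + c} h
  ... | h , h′ with T-and {0 <ᵇ a} h′
  ...   | i , j with T-and {0 <ᵇ b} j
  ...     | j , l = ≤-trans (<ᵇ⇒< 0 a i) p , ≤-trans (<ᵇ⇒< 0 b j) q , ≤-trans (<ᵇ⇒< 0 c l) r ,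
                    ≤-trans (≤ᵇ⇒≤ k _ h) (+-mono-≤ (+-mono-≤ p q) r)

  _⊑_ : Mat → Tile → Set
  xs ⊑ X = ∀ i j → xs i j ≤ m (at X i) (at X j)

  upper-⊑ : ∀ {p q r x y z} → p ≤ m x y → q ≤ m x z → r ≤ m y z → upper p q r ⊑ (x , y , z)
  upper-⊑ p q r 0F 0F = z≤n
  upper-⊑ p q r 0F 1F = p
  upper-⊑ p q r 0F 2F = q
  upper-⊑ p q r 1F 0F = z≤n
  upper-⊑ p q r 1F 1F = z≤n
  upper-⊑ p q r 1F 2F = r
  upper-⊑ p q r 2F _  = z≤n

  symm-⊑ : ∀ x y z → symm (m x y) (m x z) (m y z) ⊑ (x , y , z)
  symm-⊑ x y z 0F 0F = z≤n
  symm-⊑ x y z 0F 1F = ≤-refl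
  symm-⊑ x y z 0F 2F = ≤-refl
  symm-⊑ x y z 1F 0F = ≤-reflexive (m-sym x y)
  symm-⊑ x y z 1F 1F = z≤n
  symm-⊑ x y z 1F 2F = ≤-refl
  symm-⊑ x y z 2F 0F = ≤-reflexive (m-sym x z)
  symm-⊑ x y z 2F 1F = ≤-reflexive (m-sym y z)
  symm-⊑ x y z 2F 2F = z≤n

  cross : Tile → Tile → Mat
  cross (x , y , z) (a , b , c) =
    rows (m x a) (m x b) (m x c) (m y a) (m y b) (m y c) (m z a) (m z b) (m z c)

  cross-at : ∀ X U i k → cross X U i k ≤ m (at X i) (at U k)
  cross-at X U 0F 0F = ≤-refl
  cross-at X U 0F 1F = ≤-refl
  cross-at X U 0F 2F = ≤-refl
  cross-at X U 1F 0F = ≤-refl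
  cross-at X U 1F 1F = ≤-refl
  cross-at X U 1F 2F = ≤-refl
  cross-at X U 2F 0F = ≤-refl
  cross-at X U 2F 1F = ≤-refl
  cross-at X U 2F 2F = ≤-refl

  opaque
    apply-check : ∀ {P} → ForAllMat P → ∀ X U → T (P (cross X U))
    apply-check {P} H X U = T-allMat {P} H m≤2 m≤2 m≤2 m≤2 m≤2 m≤2 m≤2 m≤2 m≤2

  pick : ∀ (X : Tile) {f} → T (anyPick 0F 1F 2F f) →
    ∃ λ i → ∃ λ j → ∃ λ k → (at X i ∷ at X j ∷ at X k ∷ [] ↭ verts X) × T (f i j k)
  pick X {f} h with T-anyPick {f = f} h
  ... | i , j , k , p , q = i , j , k , map⁺ (at X) p , q

  Regroup : Cond → Cond → Tile → Tile → Set
  Regroup C D X U = ∃₂ λ A B → (flat (A ∷ B ∷ []) ↭ flat (X ∷ U ∷ [])) × ⟦ C ⟧ A × ⟦ D ⟧ B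

  exchange : ∀ {x y z a b c : V} {X U : Tile} →
    z ∷ x ∷ y ∷ [] ↭ verts X → a ∷ b ∷ c ∷ [] ↭ verts U →
    flat ((x , y , a) ∷ (z , b , c) ∷ []) ↭ flat (X ∷ U ∷ [])
  exchange {x} {y} {z} {a} {b} {c} {X} {U} p q =
    ↭-trans (rearrange x (z ∷ x ∷ y ∷ a ∷ b ∷ c ∷ []) (1 ∷ 2 ∷ 3 ∷ 0 ∷ 4 ∷ 5 ∷ []))
            (++⁺ p (++⁺ʳ [] q))

  swap-tiles : ∀ {A B : Tile} ts → flat (A ∷ B ∷ ts) ↭ flat (B ∷ A ∷ ts)
  swap-tiles {A} {B} ts = shifts (verts A) (verts B)

  opaque
    splitTest-sound : ∀ C D {xs ts} X U → xs ⊑ X → ts ⊑ U →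
      T (splitTest C D xs ts (cross X U)) → Regroup C D X U
    splitTest-sound C D {xs} {ts} X U x≤ t≤ h with pick X h
    ... | l , i , j , p , h with pick U h
    ...   | k , p′ , q′ , e , h with T-or h
    ...     | inj₁ h = let g₁ , g₂ = T-and h in
      _ , _ , exchange p e ,
      test-sound C g₁ (x≤ i j) (cross-at X U j k) (cross-at X U i k) ,
      test-sound D g₂ (cross-at X U l p′) (t≤ p′ q′) (cross-at X U l q′)
    ...     | inj₂ h = let g₁ , g₂ = T-and h in
      _ , _ , ↭-trans (swap-tiles []) (exchange p e) ,
      test-sound C g₂ (cross-at X U l p′) (t≤ p′ q′) (cross-at X U l q′) ,
      test-sound D g₁ (x≤ i j) (cross-at X U j k) (cross-at X U i k)

  Shaped : ℕ → ℕ → ℕ → Tile → Set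
  Shaped p q r T = ∃ λ U → (verts U ↭ verts T) × p ≤ m (at U 0F) (at U 1F) ×
    q ≤ m (at U 0F) (at U 2F) × r ≤ m (at U 1F) (at U 2F)

  shape-sound : ∀ {p q r} X → T (shape (symm (m (at X 0F) (at X 1F)) (m (at X 0F) (at X 2F)) (m (at X 1F) (at X 2F))) p q r) →
    Shaped p q r X
  shape-sound {p} {q} {r} X h with pick X h
  ... | i , j , k , e , h with T-or h
  ...   | inj₁ h = let a , b = T-and h; b , c = T-and b in
    (at X i , at X j , at X k) , e , ≤-trans (≤ᵇ⇒≤ p _ a) (symm-⊑ _ _ _ i j) ,
    ≤-trans (≤ᵇ⇒≤ q _ b) (symm-⊑ _ _ _ i k) , ≤-trans (≤ᵇ⇒≤ r _ c) (symm-⊑ _ _ _ j k)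
  ...   | inj₂ h = let a , b = T-and h; b , c = T-and b in
    (at X i , at X k , at X j) , ↭-trans (↭-prep _ (↭-swap _ _ ↭-refl)) e ,
    ≤-trans (≤ᵇ⇒≤ p _ a) (symm-⊑ _ _ _ i k) ,
    ≤-trans (≤ᵇ⇒≤ q _ b) (symm-⊑ _ _ _ i j) , ≤-trans (≤ᵇ⇒≤ r _ c) (symm-⊑ _ _ _ k j)

  opaque
    five-shape : ∀ T → 5 ≤ w T → Shaped 2 2 1 T
    five-shape T h = shape-sound T
      (check≤ 4 (T-shapes {λ w m → (w ≤ᵇ 4) ∨ shape m 2 2 1} check-five m≤2 m≤2 m≤2) h)

  opaque
    four-shape : ∀ T → 4 ≤ w T → Shaped 2 1 1 T ⊎ Shaped 2 2 0 T
    four-shape T h with T-or (check≤ 3 (T-shapes {λ w m → (w ≤ᵇ 3) ∨ (shape m 2 1 1 ∨ shape m 2 2 0)}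
                          check-four m≤2 m≤2 m≤2) h)
    ... | inj₁ p = inj₁ (shape-sound T p)
    ... | inj₂ p = inj₂ (shape-sound T p)

  opaque
    three-shape : ∀ T → 3 ≤ w T → Shaped 1 1 1 T ⊎ Shaped 2 1 0 T
    three-shape T h with T-or (check≤ 2 (T-shapes {λ w m → (w ≤ᵇ 2) ∨ (shape m 1 1 1 ∨ shape m 2 1 0)}
                          check-three m≤2 m≤2 m≤2) h)
    ... | inj₁ p = inj₁ (shape-sound T p)
    ... | inj₂ p = inj₂ (shape-sound T p)

  opaque
    six-shape : ∀ T → 6 ≤ w T → upper 2 2 2 ⊑ T
    six-shape T h with T-and (check≤ 5 (T-shapes {λ w m → (w ≤ᵇ 5) ∨ atLeast m 2 2 2 0F 1F 2F}
                          check-six m≤2 m≤2 m≤2) h)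
    ... | a , b = let b , c = T-and b in upper-⊑ (≤ᵇ⇒≤ 2 _ a) (≤ᵇ⇒≤ 2 _ b) (≤ᵇ⇒≤ 2 _ c)

  opaque
    inner : ∀ x y z → E (x ∷ y ∷ z ∷ []) (x , y , z) ≡ 2 * w (x , y , z)
    inner x y z rewrite loopless M x | loopless M y | loopless M z | m-sym y x | m-sym z x | m-sym z y =
      lemma (m x y) (m y z) (m x z)
      where
      lemma : ∀ a b c → a + c + (a + 0 + b + (c + b + 0 + 0)) ≡ 2 * (a + b + c)
      lemma = solve-∀

  opaque
    -- By `inner`, twice the weight is a sum over the vertex list of edges into the tile, and such
    -- sums do not see the order.
    w-↭ : ∀ T U → verts T ↭ verts U → w T ≡ w U
    w-↭ T U p = *-cancelˡ-≡ (w T) (w U) 2 (≡-trans (≡-sym (inner _ _ _))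
      (≡-trans (E-↭ (verts T) p) (≡-trans (sum-↭ (map⁺ (λ u → d u U) p)) (inner _ _ _))))

  opaque
    total-sym : ∀ X U → total (cross X U) ≡ total (cross U X)
    total-sym (x , y , z) (a , b , c)
      rewrite m-sym a x | m-sym a y | m-sym a z | m-sym b x | m-sym b y | m-sym b z
            | m-sym c x | m-sym c y | m-sym c z =
      arith (m x a) (m x b) (m x c) (m y a) (m y b) (m y c) (m z a) (m z b) (m z c)
      where
      arith : ∀ a b c d e f g h i →
        a + b + c + (d + e + f) + (g + h + i) ≡ a + d + g + (b + e + h) + (c + f + i)
      arith = solve-∀

≰-elim : ∀ {A : Set} {a b} → a ≤ b → b < a → A
≰-elim p q = contradiction p (<⇒≱ q)

split-≤ : ∀ a b → a ≤ b ⊎ b < a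
split-≤ a b with a ≤? b
... | yes p = inj₁ p
... | no ¬p = inj₂ (≰⇒> ¬p)

-- Degree counting over a partition into tiles

module Core {n} (M : Multigraph n) (std : Standard M) (L : List (Fin n)) (k : ℕ)
  (L-length : length L ≡ 3 * k)
  -- Degree at least 4k - 1, with `suc` in place of a subtraction.
  (L-degree : ∀ x → 4 * k ≤ suc (sum (map (μ M x) L))) where

  open Weights M std

  Good : Set
  Good = ∃₂ λ t ts → (flat (t ∷ ts) ↭ L) × ⟦ tri 4 ⟧ t × All Five ts

  -- The first vertex is the centre of the two double edges.
  Normal : Tile → Set
  Normal (a , b , c) = 2 ≤ m a b × 2 ≤ m a c × 1 ≤ m b c

  normal-⊑ : ∀ {T} → Normal T → upper 2 2 1 ⊑ T
  normal-⊑ (p , q , r) = upper-⊑ p q r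

  normal-five : ∀ {T} → Normal T → Five T
  normal-five (p , q , r) = +-mono-≤ (+-mono-≤ p r) q

  opaque
    degree-sum : ∀ us ts → flat ts ↭ L → length us * (4 * length ts) ≤ length us + sum (map (E us) ts)
    degree-sum us ts p = subst (λ k → length us * (4 * k) ≤ length us + sum (map (E us) ts)) (≡-sym len) (go us)
      where
      len : length ts ≡ k
      len = *-cancelˡ-≡ (length ts) k 3 (≡-trans (≡-sym (length-flat ts)) (≡-trans (↭-length p) L-length))
      zeros : ∀ (ts : List Tile) → sum (map (λ _ → 0) ts) ≡ 0
      zeros []       = refl
      zeros (_ ∷ ts) = zeros ts
      go : ∀ us → length us * (4 * k) ≤ length us + sum (map (E us) ts)
      go []       = z≤n
      go (u ∷ us) = begin
        4 * k + length us * (4 * k)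
          ≤⟨ +-mono-≤ (L-degree u) (go us) ⟩
        suc (sum (map (m u) L)) + (length us + sum (map (E us) ts))
          ≡⟨ cong (λ s → suc s + _) (≡-trans (sum-↭ (map⁺ (m u) (↭-sym p))) (≡-sym (d-sum-flat u ts))) ⟩
        suc (sum (map (d u) ts)) + (length us + sum (map (E us) ts))
          ≡⟨ lemma (sum (map (d u) ts)) (length us) _ ⟩
        suc (length us) + (sum (map (d u) ts) + sum (map (E us) ts))
          ≡⟨ cong (suc (length us) +_) (≡-sym (sum-map-+ (d u) (E us) ts)) ⟩
        suc (length us) + sum (map (E (u ∷ us)) ts) ∎
        where
        open ≤-Reasoning
        lemma : ∀ a b c → suc a + (b + c) ≡ suc b + (a + c)
        lemma = solve-∀

  E-++ : ∀ us fs ts → sum (map (E us) (fs ++ ts)) ≡ sum (map (E us) fs) + sum (map (E us) ts)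
  E-++ us []       ts = refl
  E-++ us (f ∷ fs) ts rewrite E-++ us fs ts = ≡-sym (+-assoc (E us f) _ _)

  opaque
    -- The vertices of `us` send on average 4 edges each to every tile, up to a total deficit of one
    -- edge per vertex. If `fs` takes so few edges that this deficit is outweighed, some tile
    -- outside lies above the average. The last two equations serve the weight count in
    -- `good-two-deficient`.
    heavy-weighted : ∀ us fs ts → flat (fs ++ ts) ↭ L → All Five ts →
      length us + sum (map (E us) fs) < length us * (4 * length fs) →
      ∃₂ λ T rest → (flat (fs ++ T ∷ rest) ↭ L) × Normal T × All Five rest × 4 * length us < E us T ×
        length ts ≡ suc (length rest) × sum (map w ts) ≡ w T + sum (map w rest)
    heavy-weighted us fs ts p fives h = finish (pigeonhole (E us) (4 * length us) ts outside)
      where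
      c i o : ℕ
      c = length us
      i = sum (map (E us) fs)
      o = sum (map (E us) ts)
      arith : ∀ c f t → c * (4 * f) + 4 * c * t ≡ c * (4 * (f + t))
      arith = solve-∀
      outside : 4 * c * length ts < o
      outside = +-cancelˡ-< (c + i) _ _ (begin-strict
        c + i + 4 * c * length ts                      <⟨ +-monoˡ-< _ h ⟩
        c * (4 * length fs) + 4 * c * length ts        ≡⟨ arith c (length fs) (length ts) ⟩
        c * (4 * (length fs + length ts))              ≡⟨ cong (λ l → c * (4 * l)) (≡-sym (length-++ fs)) ⟩
        c * (4 * length (fs ++ ts))                    ≤⟨ degree-sum us (fs ++ ts) p ⟩
        c + sum (map (E us) (fs ++ ts))                ≡⟨ cong (c +_) (E-++ us fs ts) ⟩
        c + (i + o)                                    ≡⟨ ≡-sym (+-assoc c i o) ⟩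
        c + i + o                                      ∎)
        where open ≤-Reasoning
      finish : (∃₂ λ t rest → (ts ↭ t ∷ rest) × 4 * c < E us t) →
        ∃₂ λ T rest → (flat (fs ++ T ∷ rest) ↭ L) × Normal T × All Five rest × 4 * c < E us T ×
        length ts ≡ suc (length rest) × sum (map w ts) ≡ w T + sum (map w rest)
      finish (t , rest , q , big) with All-resp-↭ q fives
      ... | f ∷ fives′ with five-shape t f
      ...   | T , e , a , b , r =
        T , rest ,
        ↭-trans (subst₂ _↭_ (≡-sym (flat-++ fs (T ∷ rest))) (≡-sym (flat-++ fs ts))
                  (++⁺ˡ (flat fs) (↭-trans (++⁺ʳ (flat rest) e) (↭-sym (flat-↭ q))))) p ,
        (a , b , r) , fives′ , subst (4 * c <_) (E-↭ us (↭-sym e)) big ,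
        ↭-length q ,
        ≡-trans (sum-↭ (map⁺ w q)) (cong (_+ sum (map w rest)) (w-↭ t T (↭-sym e)))

  heavy : ∀ us fs ts → flat (fs ++ ts) ↭ L → All Five ts →
    length us + sum (map (E us) fs) < length us * (4 * length fs) →
    ∃₂ λ T rest → (flat (fs ++ T ∷ rest) ↭ L) × Normal T × All Five rest × 4 * length us < E us T
  heavy us fs ts p fives h =
    let T , rest , q , norm , fives′ , big , _ = heavy-weighted us fs ts p fives h
    in T , rest , q , norm , fives′ , big

  -- Regroupings and the hinges of a double path

  regroup : ∀ {A B X U : Tile} ts → flat (A ∷ B ∷ []) ↭ flat (X ∷ U ∷ []) →
    flat (X ∷ U ∷ ts) ↭ L → flat (A ∷ B ∷ ts) ↭ L
  regroup ts e p = ↭-trans (++⁺ʳ (flat ts) e) p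

  opaque
    good-regroup : ∀ {X U} ts → Regroup (wt 5) (tri 4) X U → flat (X ∷ U ∷ ts) ↭ L → All Five ts → Good
    good-regroup ts (A , B , e , a , b) p fs =
      B , A ∷ ts , ↭-trans (swap-tiles ts) (regroup ts e p) , b , a ∷ fs

  reseat : ∀ {A B X U W : Tile} {ts} → flat (A ∷ B ∷ []) ↭ flat (X ∷ U ∷ []) →
    flat (X ∷ U ∷ W ∷ ts) ↭ L → flat (A ∷ W ∷ B ∷ ts) ↭ L
  reseat {A} {B} {W = W} {ts} e p =
    ↭-trans (++⁺ˡ (verts A) (swap-tiles {W} {B} ts)) (regroup (W ∷ ts) e p)

  -- These are used when X is a double path with centre y and ends i, j, and y misses U. In each
  -- case i can replace `k` in U and leave a 5-triangle. `Pinned`: j then becomes the centre of a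
  -- double path from y to `k`. `Light`: the edge from j to `k` may be simple, but replacing `k` by
  -- j instead leaves a 4-triangle and a double path from y to `k` with centre i. `DoublyPinned`:
  -- both exchanges leave a 5-triangle and a double path.
  Pinned Light Hinged : V → V → Tile → Set
  Pinned i j T = ∃ λ k → ∃₂ λ p q → (k ∷ p ∷ q ∷ [] ↭ verts T) × Five (i , p , q) × 2 ≤ m j k
  Light i j T = ∃ λ k → ∃₂ λ p q → (k ∷ p ∷ q ∷ [] ↭ verts T) × Five (i , p , q) ×
    ⟦ tri 4 ⟧ (j , p , q) × 1 ≤ m j k × 2 ≤ m i k
  Hinged i j T = Pinned i j T ⊎ Light i j T

  DoublyPinned : V → V → Tile → Set
  DoublyPinned i j T = ∃ λ k → ∃₂ λ p q → (k ∷ p ∷ q ∷ [] ↭ verts T) ×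
    Five (i , p , q) × Five (j , p , q) × 2 ≤ m i k × 2 ≤ m j k

  absorbs-sound : ∀ {ts} X U i p q → ts ⊑ U → T (absorbs ts (cross X U) i p q) →
    Five (at X i , at U p , at U q)
  absorbs-sound X U i p q t≤ h = test-sound (wt 5) h (cross-at X U i p) (t≤ p q) (cross-at X U i q)

  hinges-sound : ∀ {ts} X U i j → ts ⊑ U → T (hinges ts (cross X U) i j) → Hinged (at X i) (at X j) U
  hinges-sound {ts} X U i j t≤ h with T-or {anyPick 0F 1F 2F (hingeAt ts (cross X U) i j)} h
  ... | inj₁ h =
    let k , p , q , e , h = pick U {hingeAt ts (cross X U) i j} h
        a , b = T-and {absorbs ts (cross X U) i p q} h
    in inj₁ (_ , _ , _ , e , absorbs-sound X U i p q t≤ a ,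
             ≤-trans (≤ᵇ⇒≤ 2 (cross X U j k) b) (cross-at X U j k))
  ... | inj₂ h =
    let k , p , q , e , h = pick U {lightHingeAt ts (cross X U) i j} h
        a , h = T-and {absorbs ts (cross X U) i p q} h
        b , h = T-and {test (tri 4) (cross X U j p) (ts p q) (cross X U j q)} h
        c , d = T-and {1 ≤ᵇ cross X U j k} h
    in inj₂ (_ , _ , _ , e , absorbs-sound X U i p q t≤ a ,
             test-sound (tri 4) b (cross-at X U j p) (t≤ p q) (cross-at X U j q) ,
             ≤-trans (≤ᵇ⇒≤ 1 (cross X U j k) c) (cross-at X U j k) ,
             ≤-trans (≤ᵇ⇒≤ 2 (cross X U i k) d) (cross-at X U i k))

  doubleHinge-sound : ∀ {ts} X U → ts ⊑ U → T (doubleHinge ts (cross X U)) →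
    DoublyPinned (at X 1F) (at X 2F) U
  doubleHinge-sound {ts} X U t≤ h =
    let k , p , q , e , h = pick U {doubleHingeAt ts (cross X U)} h
        a , h = T-and {absorbs ts (cross X U) 1F p q} h
        b , h = T-and {absorbs ts (cross X U) 2F p q} h
        c , d = T-and {2 ≤ᵇ cross X U 1F k} h
    in _ , _ , _ , e , absorbs-sound X U 1F p q t≤ a , absorbs-sound X U 2F p q t≤ b ,
       ≤-trans (≤ᵇ⇒≤ 2 (cross X U 1F k) c) (cross-at X U 1F k) ,
       ≤-trans (≤ᵇ⇒≤ 2 (cross X U 2F k) d) (cross-at X U 2F k)

  opaque
    analyse : ∀ y x z U ts → 2 ≤ m y x → 2 ≤ m y z → flat ((y , x , z) ∷ U ∷ ts) ↭ L →
      Normal U → All Five ts → 8 < d x U + d z U →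
      Good ⊎ (d y U ≤ 0 × (DoublyPinned x z U ⊎
        (d x U + d z U ≤ 10 × (Hinged z x U ⊎ Hinged x z U))))
    analyse y x z U ts yx yz p norm fs big
      with T-or (check≤ 8 (apply-check check-220 (y , x , z) U) big)
    ... | inj₁ h = inj₁ (good-regroup ts
      (splitTest-sound (wt 5) (tri 4) _ U (upper-⊑ yx yz z≤n) (normal-⊑ norm) h) p fs)
    ... | inj₂ h with T-and h
    ...   | h₀ , h with T-or h
    ...     | inj₁ h = inj₂ (≤ᵇ⇒≤ _ 0 h₀ , inj₁ (doubleHinge-sound (y , x , z) U (normal-⊑ norm) h))
    ...     | inj₂ h with T-and h
    ...       | h₁ , h with T-or h
    ...         | inj₁ h = inj₂ (≤ᵇ⇒≤ _ 0 h₀ , inj₂ (≤ᵇ⇒≤ _ 10 h₁ ,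
                    inj₁ (hinges-sound (y , x , z) U 2F 1F (normal-⊑ norm) h)))
    ...         | inj₂ h = inj₂ (≤ᵇ⇒≤ _ 0 h₀ , inj₂ (≤ᵇ⇒≤ _ 10 h₁ ,
                    inj₂ (hinges-sound (y , x , z) U 1F 2F (normal-⊑ norm) h)))

  opaque
    isolated : ∀ y x z U ts → 2 ≤ m y x → 2 ≤ m y z → flat ((y , x , z) ∷ U ∷ ts) ↭ L →
      Normal U → All Five ts → 8 < d x U + d z U → Good ⊎ d y U ≤ 0
    isolated y x z U ts yx yz p norm fs big = Sum.map₂ proj₁ (analyse y x z U ts yx yz p norm fs big)

  d-member : ∀ {y k p q T} → k ∷ p ∷ q ∷ [] ↭ verts T → d y T ≤ 0 → m k y ≤ 0
  d-member {y} {k} {p} {q} {T} e h = begin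
    m k y                     ≡⟨ m-sym k y ⟩
    m y k                     ≤⟨ ≤-trans (m≤m+n _ (m y p)) (m≤m+n _ (m y q)) ⟩
    d y (k , p , q)           ≡⟨ d-↭ {y} {k , p , q} {T} e ⟩
    d y T                     ≤⟨ h ⟩
    0                         ∎
    where open ≤-Reasoning

  m-self : ∀ {x} → m x x ≤ 0
  m-self {x} = ≤-reflexive (loopless M x)

  path-d : ∀ {y x z} → m x z ≤ 0 → (d y (y , x , z) ≤ 4) × (d x (y , x , z) ≤ 2) × (d z (y , x , z) ≤ 2)
  path-d {y} {x} {z} xz =
    +-mono-≤ (+-mono-≤ m-self m≤2) m≤2 ,
    +-mono-≤ (+-mono-≤ m≤2 m-self) xz ,
    +-mono-≤ (+-mono-≤ m≤2 (≤-trans (≤-reflexive (m-sym z x)) xz)) m-self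

  reseat-z : ∀ {y x z k p q : V} {U : Tile} → k ∷ p ∷ q ∷ [] ↭ verts U →
    flat ((z , y , k) ∷ (x , p , q) ∷ []) ↭ flat ((y , x , z) ∷ U ∷ [])
  reseat-z {y} {x} {z} {k} {p} {q} e = ↭-trans
    (rearrange y (y ∷ x ∷ z ∷ k ∷ p ∷ q ∷ []) (2 ∷ 0 ∷ 3 ∷ 1 ∷ 4 ∷ 5 ∷ []))
    (++⁺ˡ (y ∷ x ∷ z ∷ []) (++⁺ʳ [] e))

  reseat-x : ∀ {y x z k p q : V} {U : Tile} → k ∷ p ∷ q ∷ [] ↭ verts U →
    flat ((x , y , k) ∷ (z , p , q) ∷ []) ↭ flat ((y , x , z) ∷ U ∷ [])
  reseat-x {y} {x} {z} {k} {p} {q} e = ↭-trans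
    (rearrange y (y ∷ x ∷ z ∷ k ∷ p ∷ q ∷ []) (1 ∷ 0 ∷ 3 ∷ 2 ∷ 4 ∷ 5 ∷ []))
    (++⁺ˡ (y ∷ x ∷ z ∷ []) (++⁺ʳ [] e))

  private
    arith₁ : ∀ a b c e → a + (b + (c + (c + (e + (e + 0))))) ≡ (a + b) + ((c + e) + (c + e))
    arith₁ = solve-∀

  opaque
    -- With x, z counted once and y, k twice, X takes at most 2 + 2 + 8 + 8 and U at most 6 + 6 + 0
    -- + 8. Then 6 + 40 < 6 · 8, as `heavy` requires.
    doubly-pinned-inside : ∀ {y x z k p q} U → m x z ≤ 0 → k ∷ p ∷ q ∷ [] ↭ verts U → d y U ≤ 0 →
      sum (map (E (x ∷ z ∷ y ∷ y ∷ k ∷ k ∷ [])) ((y , x , z) ∷ U ∷ [])) ≤ 40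
    doubly-pinned-inside {y} {x} {z} {k} U xz e yU =
      let y≤4 , x≤2 , z≤2 = path-d {y} {x} {z} xz
          kX : d k (y , x , z) ≤ 4
          kX = +-mono-≤ (+-mono-≤ (d-member {T = U} e yU) m≤2) m≤2
          kU : d k U ≤ 4
          kU = d-self≤4 {T = U} e
      in +-mono-≤ {x = E (x ∷ z ∷ y ∷ y ∷ k ∷ k ∷ []) (y , x , z)} {20}
           (+-mono-≤ x≤2 (+-mono-≤ z≤2 (+-mono-≤ y≤4 (+-mono-≤ y≤4 (+-mono-≤ kX (+-mono-≤ kX (z≤n {0})))))))
           (+-mono-≤ {x = E (x ∷ z ∷ y ∷ y ∷ k ∷ k ∷ []) U} {20}
             (+-mono-≤ (d≤6 U) (+-mono-≤ (d≤6 U) (+-mono-≤ yU (+-mono-≤ yU (+-mono-≤ kU (+-mono-≤ kU (z≤n {0})))))))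
             (z≤n {0}))

  opaque
    -- Some W receives more than 24 weighted edges. If x and z send more than 8, `isolated` makes y
    -- miss W. If y and k do, it makes both x and z miss W, since after the two exchanges each is
    -- the centre of a double path from y to k. Either way, and also if neither happens, at most 24
    -- edges remain.
    doubly-pinned : ∀ y x z U ts → 2 ≤ m y x → 2 ≤ m y z → m x z ≤ 0 →
      flat ((y , x , z) ∷ U ∷ ts) ↭ L → Five U → All Five ts → d y U ≤ 0 → DoublyPinned x z U → Good
    doubly-pinned y x z U ts yx yz xz perm fU fs yU (k , p , q , e , fx , fz , xk , zk)
      with heavy (x ∷ z ∷ y ∷ y ∷ k ∷ k ∷ []) ((y , x , z) ∷ U ∷ []) ts perm fs
             (s≤s (≤-trans (+-monoʳ-≤ 6 (doubly-pinned-inside U xz e yU)) (n≤1+n 46)))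
    ... | W , rest , perm′ , norm , fs′ , big with split-≤ (d x W + d z W) 8 | split-≤ (d y W + d k W) 8
    ...   | inj₂ xzW | _ = [ (λ g → g) , (λ yW → ≰-elim
            (+-mono-≤ (d≤6 {x} W) (+-mono-≤ (d≤6 {z} W) (+-mono-≤ yW (+-mono-≤ yW
              (+-mono-≤ (d≤6 {k} W) (+-mono-≤ (d≤6 {k} W) (z≤n {0}))))))) big) ]
            (isolated y x z W (U ∷ rest) yx yz
              (↭-trans (++⁺ˡ (y ∷ x ∷ z ∷ []) (swap-tiles {W} {U} rest)) perm′) norm (fU ∷ fs′) xzW)
    ...   | inj₁ xzW | inj₁ ykW = ≰-elim (subst (_≤ 24) (≡-sym (arith₁ (d x W) (d z W) (d y W) (d k W)))
            (+-mono-≤ xzW (+-mono-≤ ykW ykW))) big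
    ...   | inj₁ xzW | inj₂ ykW
      with isolated z y k W ((x , p , q) ∷ rest) (subst (2 ≤_) (m-sym y z) yz) zk
             (reseat {z , y , k} {x , p , q} {y , x , z} {U} {W} {rest} (reseat-z {y} {x} {z} {U = U} e) perm′) norm (fx ∷ fs′) ykW
         | isolated x y k W ((z , p , q) ∷ rest) (subst (2 ≤_) (m-sym y x) yx) xk
             (reseat {x , y , k} {z , p , q} {y , x , z} {U} {W} {rest} (reseat-x {y} {x} {z} {U = U} e) perm′) norm (fz ∷ fs′) ykW
    ...     | inj₁ g  | _       = g
    ...     | inj₂ _  | inj₁ g  = g
    ...     | inj₂ zW | inj₂ xW = ≰-elim
              (+-mono-≤ xW (+-mono-≤ zW (+-mono-≤ (d≤6 {y} W) (+-mono-≤ (d≤6 {y} W)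
                (+-mono-≤ (d≤6 {k} W) (+-mono-≤ (d≤6 {k} W) (z≤n {0}))))))) big

  opaque
    confined : ∀ y x z U ts → 2 ≤ m y x → 2 ≤ m y z → m x z ≤ 0 →
      flat ((y , x , z) ∷ U ∷ ts) ↭ L → Normal U → All Five ts → 8 < d x U + d z U →
      Good ⊎ (d y U ≤ 0 × d x U + d z U ≤ 10 × (Hinged z x U ⊎ Hinged x z U))
    confined y x z U ts yx yz xz perm norm fs big with analyse y x z U ts yx yz perm norm fs big
    ... | inj₁ g = inj₁ g
    ... | inj₂ (yU , inj₁ p) =
      inj₁ (doubly-pinned y x z U ts yx yz xz perm (normal-five {U} norm) fs yU p)
    ... | inj₂ (yU , inj₂ (s , h)) = inj₂ (yU , s , h)

  private
    arith₂ : ∀ y x z k → y + (x + (z + (k + 0))) ≡ (x + z) + (y + k)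
    arith₂ = solve-∀
    arith₃ : ∀ y x z k → y + (x + (z + (k + 0))) ≡ y + ((x + z) + k)
    arith₃ = solve-∀
    arith₄ : ∀ y x z k → y + (x + (z + (k + 0))) ≡ x + ((y + k) + z)
    arith₄ = solve-∀
    arith₅ : ∀ y x z k → y + (x + (z + (k + 0))) ≡ x + (z + y + k)
    arith₅ = solve-∀

  opaque
    -- Over y, x, z, k the tiles X and U take at most 12 and 14 edges, and 4 + 26 < 32, so some W
    -- receives more than 16. If x and z sent more than 8, y would miss W and x, z would send at
    -- most 10, leaving at most 16 in all. So y and k send more than 8.
    second-tile : ∀ y x z U ts {k p q} → 2 ≤ m y x → 2 ≤ m y z → m x z ≤ 0 →
      flat ((y , x , z) ∷ U ∷ ts) ↭ L → Five U → All Five ts → d y U ≤ 0 → d x U + d z U ≤ 10 →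
      k ∷ p ∷ q ∷ [] ↭ verts U →
      Good ⊎ (∃₂ λ W rest → (flat ((y , x , z) ∷ U ∷ W ∷ rest) ↭ L) × Normal W × All Five rest ×
        8 < d y W + d k W × 16 < d y W + (d x W + (d z W + (d k W + 0))))
    second-tile y x z U ts {k} yx yz xz perm fU fs yU sU e
      with heavy (y ∷ x ∷ z ∷ k ∷ []) ((y , x , z) ∷ U ∷ []) ts perm fs
             (s≤s (≤-trans (+-monoʳ-≤ 4 (+-mono-≤ inX (+-monoˡ-≤ 0 inU))) (n≤1+n 30)))
      where
      inX : E (y ∷ x ∷ z ∷ k ∷ []) (y , x , z) ≤ 12
      inX = let y≤4 , x≤2 , z≤2 = path-d {y} {x} {z} xz in
        +-mono-≤ y≤4 (+-mono-≤ x≤2 (+-mono-≤ z≤2 (+-mono-≤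
          (+-mono-≤ {y = 2} {v = 2} (+-mono-≤ {y = 0} (d-member {T = U} e yU) m≤2) m≤2) (z≤n {0}))))
      inU : E (y ∷ x ∷ z ∷ k ∷ []) U ≤ 14
      inU = subst (_≤ 14) (≡-sym (arith₃ (d y U) (d x U) (d z U) (d k U)))
        (+-mono-≤ yU (+-mono-≤ sU (d-self≤4 {T = U} e)))
    ... | W , rest , perm′ , norm , fs′ , big with split-≤ (d x W + d z W) 8 | split-≤ (d y W + d k W) 8
    ...   | inj₁ s | inj₁ t = ≰-elim (subst (_≤ 16) (≡-sym (arith₂ (d y W) (d x W) (d z W) (d k W))) (+-mono-≤ s t)) big
    ...   | inj₁ s | inj₂ t = inj₂ (W , rest , perm′ , norm , fs′ , t , big)
    ...   | inj₂ s | _ = [ inj₁ , (λ (yW , s≤10 , _) → ≰-elim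
              (subst (_≤ 16) (≡-sym (arith₃ (d y W) (d x W) (d z W) (d k W)))
                (+-mono-≤ yW (+-mono-≤ s≤10 (d≤6 {k} W)))) big) ]
            (confined y x z W (U ∷ rest) yx yz xz
              (↭-trans (++⁺ˡ (y ∷ x ∷ z ∷ []) (swap-tiles {W} {U} rest)) perm′) norm (fU ∷ fs′) s)

  opaque
    resolve-hinge : ∀ y x z U ts → 2 ≤ m y x → 2 ≤ m y z → m x z ≤ 0 →
      flat ((y , x , z) ∷ U ∷ ts) ↭ L → Five U → All Five ts → d y U ≤ 0 → d x U + d z U ≤ 10 →
      Hinged z x U → Good
    resolve-hinge y x z U ts yx yz xz perm fU fs yU sU (inj₁ (k , p , q , e , fz , xk))
      with second-tile y x z U ts yx yz xz perm fU fs yU sU e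
    ... | inj₁ g = g
    -- The exchange makes x the centre of a double path from y to k. By `confined`, x misses W and
    -- y, k send at most 10, so with 6 from z at most 16 edges reach W.
    ... | inj₂ (W , rest , perm′ , norm , fs′ , t , big) =
      [ (λ g → g) , (λ (xW , t≤10 , _) → ≰-elim
          (subst (_≤ 16) (≡-sym (arith₄ (d y W) (d x W) (d z W) (d k W)))
            (+-mono-≤ xW (+-mono-≤ t≤10 (d≤6 {z} W)))) big) ]
        (confined x y k W ((z , p , q) ∷ rest) (subst (2 ≤_) (m-sym y x) yx) xk
          (subst (_≤ 0) (m-sym k y) (d-member {T = U} e yU))
          (reseat {x , y , k} {z , p , q} {y , x , z} {U} {W} {rest} (reseat-x {y} {x} {z} {U = U} e) perm′)
          norm (fz ∷ fs′) t)
    resolve-hinge y x z U ts yx yz xz perm fU fs yU sU (inj₂ (k , p , q , e , fz , triₓ , xk , zk))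
      with second-tile y x z U ts yx yz xz perm fU fs yU sU e
    ... | inj₁ g = g
    ... | inj₂ (W , rest , perm′ , norm , fs′ , t , big)
      with T-or (check≤ 8 (apply-check check-path (x , y , k) W) t)
    ...   | inj₁ h = good-regroup ((z , p , q) ∷ rest)
              (splitTest-sound (wt 5) (tri 4) (x , y , k) W
                (upper-⊑ (subst (2 ≤_) (m-sym y x) yx) xk z≤n) (normal-⊑ {W} norm) h)
              (reseat {x , y , k} {z , p , q} {y , x , z} {U} {W} {rest} (reseat-x {y} {x} {z} {U = U} e) perm′)
              (fz ∷ fs′)
    -- Now x sends at most one edge to W, so z, y, k send at least 16. They and W split into two
    -- 5-triangles, and x, p, q form the 4-triangle.
    ...   | inj₂ h with splitTest-sound (wt 5) (wt 5) (z , y , k) W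
              (upper-⊑ (subst (2 ≤_) (m-sym y z) yz) zk z≤n) (normal-⊑ {W} norm)
              (check≤ {total (cross (z , y , k) W)} 15 (apply-check check-full (z , y , k) W)
                (+-cancelˡ-< 1 15 (total (cross (z , y , k) W)) (<-≤-trans (subst (16 <_) (arith₅ (d y W) (d x W) (d z W) (d k W)) big)
                  (+-monoˡ-≤ (total (cross (z , y , k) W)) (≤ᵇ⇒≤ (d x W) 1 h)))))
    ...     | A , B , f , a , b =
              (x , p , q) , A ∷ B ∷ rest ,
              ↭-trans (flat-↭ (↭-sym (shift (x , p , q) (A ∷ B ∷ []) rest)))
                (regroup {A} {B} {z , y , k} {W} ((x , p , q) ∷ rest) f
                  (reseat {z , y , k} {x , p , q} {y , x , z} {U} {W} {rest} (reseat-z {y} {x} {z} {U = U} e) perm′)) ,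
              triₓ , a ∷ b ∷ fs′

  opaque
    -- The ends send at most 2 edges each into the path and 2 + 4 < 8, so some U receives at least 9
    -- edges from them. The two orientations of a hinge are mirror images under exchanging x and z.
    good-path : ∀ y x z ts → 2 ≤ m y x → 2 ≤ m y z → m x z ≤ 0 →
      flat ((y , x , z) ∷ ts) ↭ L → All Five ts → Good
    good-path y x z ts yx yz xz perm fs
      with heavy (x ∷ z ∷ []) ((y , x , z) ∷ []) ts perm fs
             (let _ , x≤2 , z≤2 = path-d {y} {x} {z} xz in
              s≤s (≤-trans (+-monoʳ-≤ 2 (+-monoˡ-≤ 0 (+-mono-≤ x≤2 (+-monoˡ-≤ 0 z≤2)))) (n≤1+n 6)))
    ... | U , rest , perm′ , norm , fs′ , big
      with confined y x z U rest yx yz xz perm′ norm fs′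
             (subst (λ t → 8 < d x U + t) (+-identityʳ (d z U)) big)
    ...   | inj₁ g = g
    ...   | inj₂ (yU , s , inj₁ h) = resolve-hinge y x z U rest yx yz xz perm′ (normal-five {U} norm) fs′ yU s h
    ...   | inj₂ (yU , s , inj₂ h) = resolve-hinge y z x U rest yz yx (subst (_≤ 0) (m-sym x z) xz)
              (↭-trans (↭-prep y (↭-swap z x ↭-refl)) perm′) (normal-five {U} norm) fs′ yU
              (subst (_≤ 10) (+-comm (d x U) (d z U)) s) h

  -- One deficient tile

  opaque
    -- Two double edges make a 4-triangle as soon as their far ends are adjacent; otherwise the tile
    -- is a double path.
    good-four : ∀ X ts → flat (X ∷ ts) ↭ L → All Five ts → 4 ≤ w X → Good
    good-four X ts perm fs h with four-shape X h
    ... | inj₁ (U , e , a , b , c) =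
      U , ts , ↭-trans (++⁺ʳ (flat ts) e) perm ,
      (≤-trans (s≤s z≤n) a , c , b , +-mono-≤ (+-mono-≤ a c) b) , fs
    ... | inj₂ (U@(y , x , z) , e , a , b , _) with split-≤ (m x z) 0
    ...   | inj₁ xz = good-path y x z ts a b xz (↭-trans (++⁺ʳ (flat ts) e) perm) fs
    ...   | inj₂ xz = U , ts , ↭-trans (++⁺ʳ (flat ts) e) perm ,
      (≤-trans (s≤s z≤n) a , xz , ≤-trans (s≤s z≤n) b ,
       ≤-trans (n≤1+n 4) (+-mono-≤ (+-mono-≤ a xz) b)) , fs

  total-E : ∀ X U → E (verts X) U ≡ total (cross X U)
  total-E (x , y , z) U = arith (d x U) (d y U) (d z U)
    where
    arith : ∀ a b c → a + (b + (c + 0)) ≡ a + b + c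
    arith = solve-∀

  opaque
    -- By `inner` at most 8 edges are counted inside X, and 3 + 8 < 12.
    heavy-tile : ∀ X ts → flat (X ∷ ts) ↭ L → All Five ts → w X ≤ 4 →
      ∃₂ λ U rest → (flat (X ∷ U ∷ rest) ↭ L) × Normal U × All Five rest × 12 < total (cross X U)
    heavy-tile X@(x , y , z) ts perm fs h
      with heavy (verts X) (X ∷ []) ts perm fs
             (s≤s (+-monoʳ-≤ 3 (+-monoˡ-≤ 0 (≤-trans (≤-reflexive (inner x y z)) (*-monoʳ-≤ 2 h)))))
    ... | U , rest , perm′ , norm , fs′ , big =
      U , rest , perm′ , norm , fs′ , subst (12 <_) (total-E X U) big

  opaque
    good-three : ∀ X ts → flat (X ∷ ts) ↭ L → All Five ts → 3 ≤ w X → Good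
    good-three X ts perm fs h with split-≤ 4 (w X)
    ... | inj₁ h≥4 = good-four X ts perm fs h≥4
    ... | inj₂ h<4 = [ (λ (U , e , a , b , c) → step U e (upper-⊑ a b c) check-111) ,
                       (λ (U , e , a , b , c) → step U e (upper-⊑ a b c) check-210) ] (three-shape X h)
      where
      step : ∀ {xs} U → verts U ↭ verts X → xs ⊑ U →
        ForAllMat (λ c → (total c ≤ᵇ 12) ∨ splitTest (wt 5) (wt 4) xs (upper 2 2 1) c) → Good
      step U e x≤ check with split-≤ 4 (w U)
      ... | inj₁ h≥4 = good-four U ts (↭-trans (++⁺ʳ (flat ts) e) perm) fs h≥4
      ... | inj₂ h<4 with heavy-tile U ts (↭-trans (++⁺ʳ (flat ts) e) perm) fs (<⇒≤ h<4)
      ...   | W , rest , perm′ , norm , fs′ , big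
        with splitTest-sound (wt 5) (wt 4) U W x≤ (normal-⊑ {W} norm) (check≤ 12 (apply-check check U W) big)
      ...     | A , B , f , a , b = good-four B (A ∷ rest)
                (↭-trans (swap-tiles {B} {A} rest) (regroup {A} {B} {U} {W} rest f perm′)) (a ∷ fs′) b

  opaque
    good-one-deficient : ∀ X ts → flat (X ∷ ts) ↭ L → All Five ts → Good
    good-one-deficient X ts perm fs with split-≤ 3 (w X)
    ... | inj₁ h = good-three X ts perm fs h
    ... | inj₂ h with heavy-tile X ts perm fs (≤-trans (<⇒≤ h) (n≤1+n 3))
    ...   | W , rest , perm′ , norm , fs′ , big
      with splitTest-sound (wt 5) (wt 3) X W (upper-⊑ z≤n z≤n z≤n) (normal-⊑ {W} norm)
             (check≤ 12 (apply-check check-any X W) big)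
    ...     | A , B , f , a , b = good-three B (A ∷ rest)
              (↭-trans (swap-tiles {B} {A} rest) (regroup {A} {B} {X} {W} rest f perm′)) (a ∷ fs′) b

  -- Two deficient tiles

  Attach : Tile → V → Set
  Attach Z t = ∃ λ l → ∃₂ λ i j → (l ∷ i ∷ j ∷ [] ↭ verts Z) × Five (i , j , t)

  Cover : Tile → V → V → Set
  Cover Z p q = ∃ λ l → ∃₂ λ i j → (l ∷ i ∷ j ∷ [] ↭ verts Z) × Five (l , p , q)

  attached-sound : ∀ {xs} Z U k → xs ⊑ Z → T (attached xs (cross Z U) k) → Attach Z (at U k)
  attached-sound {xs} Z U k x≤ h =
    let l , i , j , e , h = pick Z {λ l i j → 5 ≤ᵇ xs i j + cross Z U j k + cross Z U i k} h
    in _ , _ , _ , e , test-sound (wt 5) h (x≤ i j) (cross-at Z U j k) (cross-at Z U i k)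

  covered-sound : ∀ {ts} Z U p q → ts ⊑ U → T (covered ts (cross Z U) p q) → Cover Z (at U p) (at U q)
  covered-sound {ts} Z U p q t≤ h =
    let l , i , j , e , h = pick Z {λ l i j → absorbs ts (cross Z U) l p q} h
    in _ , _ , _ , e , absorbs-sound Z U l p q t≤ h

  -- Nothing is asked of `C`: it becomes the single deficient tile.
  TwoFives : Tile → Tile → Tile → Set
  TwoFives X Y U = ∃ λ A → ∃₂ λ B C → (flat (A ∷ B ∷ C ∷ []) ↭ flat (X ∷ Y ∷ U ∷ [])) × Five A × Five B

  module _ {X Y U : Tile} {t p q : V} (e : t ∷ p ∷ q ∷ [] ↭ verts U) where

    attach-cover : Attach X t → Cover Y p q → TwoFives X Y U
    attach-cover (l , i , j , eX , f) (l′ , i′ , j′ , eY , f′) =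
      (i , j , t) , (l′ , p , q) , (l , i′ , j′) ,
      ↭-trans (rearrange l (l ∷ i ∷ j ∷ l′ ∷ i′ ∷ j′ ∷ t ∷ p ∷ q ∷ []) (1 ∷ 2 ∷ 6 ∷ 3 ∷ 7 ∷ 8 ∷ 0 ∷ 4 ∷ 5 ∷ []))
        (++⁺ eX (++⁺ eY (++⁺ʳ [] e))) , f , f′

    attach-attach : Attach X t → Attach Y p → TwoFives X Y U
    attach-attach (l , i , j , eX , f) (l′ , i′ , j′ , eY , f′) =
      (i , j , t) , (i′ , j′ , p) , (l , l′ , q) ,
      ↭-trans (rearrange l (l ∷ i ∷ j ∷ l′ ∷ i′ ∷ j′ ∷ t ∷ p ∷ q ∷ []) (1 ∷ 2 ∷ 6 ∷ 4 ∷ 5 ∷ 7 ∷ 0 ∷ 3 ∷ 8 ∷ []))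
        (++⁺ eX (++⁺ eY (++⁺ʳ [] e))) , f , f′

    cover-attach : Cover X p q → Attach Y t → TwoFives X Y U
    cover-attach (l , i , j , eX , f) (l′ , i′ , j′ , eY , f′) =
      (l , p , q) , (i′ , j′ , t) , (i , j , l′) ,
      ↭-trans (rearrange l (l ∷ i ∷ j ∷ l′ ∷ i′ ∷ j′ ∷ t ∷ p ∷ q ∷ []) (0 ∷ 7 ∷ 8 ∷ 4 ∷ 5 ∷ 6 ∷ 1 ∷ 2 ∷ 3 ∷ []))
        (++⁺ eX (++⁺ eY (++⁺ʳ [] e))) , f , f′

  opaque
    meet-sound : ∀ {xs ys ts} X Y U k p q → xs ⊑ X → ys ⊑ Y → ts ⊑ U →
      at U k ∷ at U p ∷ at U q ∷ [] ↭ verts U →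
      T (meet (attached xs (cross X U) k) (covered ts (cross X U) p q)
              (attached ys (cross Y U) k) (covered ts (cross Y U) p q)
              (attached ys (cross Y U) p) (attached ys (cross Y U) q)) →
      TwoFives X Y U
    meet-sound {xs} {ys} {ts} X Y U k p q x≤ y≤ t≤ e h
      with T-or {attached xs (cross X U) k ∧
                 (covered ts (cross Y U) p q ∨ (attached ys (cross Y U) p ∨ attached ys (cross Y U) q))} h
    ... | inj₂ h = let a , b = T-and {covered ts (cross X U) p q} h in
      cover-attach e (covered-sound X U p q t≤ a) (attached-sound Y U k y≤ b)
    ... | inj₁ h with T-and {attached xs (cross X U) k} h
    ...   | a , h with T-or {covered ts (cross Y U) p q} h
    ...     | inj₁ b = attach-cover e (attached-sound X U k x≤ a) (covered-sound Y U p q t≤ b)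
    ...     | inj₂ h with T-or {attached ys (cross Y U) p} h
    ...       | inj₁ b = attach-attach e (attached-sound X U k x≤ a) (attached-sound Y U p y≤ b)
    ...       | inj₂ b = attach-attach (↭-trans (↭-prep _ (↭-swap _ _ ↭-refl)) e)
                           (attached-sound X U k x≤ a) (attached-sound Y U q y≤ b)

  opaque
    -- The two bounds sum to more than 24, so by `check-codes` some vertex of U passes `meet`.
    codes-sound : ∀ {xs ys ts} X Y U → xs ⊑ X → ys ⊑ Y → ts ⊑ U →
      total (cross X U) ≤ codeBound xs ts (cross X U) →
      total (cross Y U) ≤ codeBound ys ts (cross Y U) →
      24 < total (cross X U) + total (cross Y U) → TwoFives X Y U
    codes-sound {xs} {ys} {ts} X Y U x≤ y≤ t≤ hX hY big =
      decode (check≤ {codeBound xs ts c + codeBound ys ts c′} 24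
        (T-allBits 12 {codesMeet} (holds check-codes)
          (s 0F ∷ s 1F ∷ s 2F ∷ v 1F 2F ∷ v 0F 2F ∷ v 0F 1F ∷
           s′ 0F ∷ s′ 1F ∷ s′ 2F ∷ v′ 1F 2F ∷ v′ 0F 2F ∷ v′ 0F 1F ∷ []))
        (<-≤-trans big (+-mono-≤ hX hY)))
      where
      c c′ : Mat
      c = cross X U
      c′ = cross Y U
      s s′ : Fin 3 → Bool
      s = attached xs c
      s′ = attached ys c′
      v v′ : Fin 3 → Fin 3 → Bool
      v = covered ts c
      v′ = covered ts c′
      decode : T (compatible (s 0F) (s 1F) (s 2F) (v 1F 2F) (v 0F 2F) (v 0F 1F)
                             (s′ 0F) (s′ 1F) (s′ 2F) (v′ 1F 2F) (v′ 0F 2F) (v′ 0F 1F)) → TwoFives X Y U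
      decode h with T-or {meet (s 0F) (v 1F 2F) (s′ 0F) (v′ 1F 2F) (s′ 1F) (s′ 2F)} h
      ... | inj₁ h = meet-sound X Y U 0F 1F 2F x≤ y≤ t≤ ↭-refl h
      ... | inj₂ h with T-or {meet (s 1F) (v 0F 2F) (s′ 1F) (v′ 0F 2F) (s′ 0F) (s′ 2F)} h
      ...   | inj₁ h = meet-sound X Y U 1F 0F 2F x≤ y≤ t≤ (↭-swap _ _ ↭-refl) h
      ...   | inj₂ h = meet-sound X Y U 2F 0F 1F x≤ y≤ t≤
                         (rearrange (at U 0F) (verts U) (2 ∷ 0 ∷ 1 ∷ [])) h

  -- The checks available for one shape of deficient tile, bundled so that the shapes 2, 1, 1 and 2,
  -- 2, 0 are treated alike.
  Profile : Mat → Set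
  Profile xs = ForAllMat (codeTest221 xs) × ForAllMat (codeTest222 xs) ×
    ForAllMat (λ c → (total c ≤ᵇ 12) ∨ splitTest (wt 5) (wt 0) (upper 0 0 0) xs c)

  four-profile : ∀ X → 4 ≤ w X →
    ∃ λ U → (verts U ↭ verts X) × 4 ≤ w U × (∃ λ xs → (xs ⊑ U) × Profile xs)
  four-profile X h with four-shape X h
  ... | inj₁ (U , e , a , b , c) = U , e , +-mono-≤ (+-mono-≤ a c) b ,
    _ , upper-⊑ a b c , check-211-221 , check-211-222 , check-any-211
  ... | inj₂ (U , e , a , b , c) = U , e , +-mono-≤ (+-mono-≤ a c) b ,
    _ , upper-⊑ a b c , check-220-221 , check-220-222 , check-any-220

  Improves : Tile → Tile → Set
  Improves Z U = w U ≤ 5 × Regroup (wt 6) (wt 4) Z U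

  Outcome : Mat → Mat → Tile → Tile → Set
  Outcome xs ts Z U = Regroup (wt 5) (wt 5) Z U ⊎ (Improves Z U ⊎ total (cross Z U) ≤ codeBound xs ts (cross Z U))

  opaque
    -- A tile U of weight 5 may be exchanged for a 6-triangle. For U of weight 6 the stronger bounds
    -- 2, 2, 2 inside U make that outcome unnecessary.
    outcomes : ∀ {xs ys} X Y U → xs ⊑ X → Profile xs → ys ⊑ Y → Profile ys → Normal U →
      ∃ λ ts → (ts ⊑ U) × Outcome xs ts X U × Outcome ys ts Y U
    outcomes {xs} {ys} X Y U x≤ px y≤ py norm with split-≤ (w U) 5
    ... | inj₁ light = upper 2 2 1 , normal-⊑ {U} norm , go X x≤ px , go Y y≤ py
      where
      go : ∀ {zs} Z → zs ⊑ Z → Profile zs → Outcome zs (upper 2 2 1) Z U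
      go {zs} Z z≤ (check , _) with T-or (apply-check check Z U)
      ... | inj₁ h = inj₁ (splitTest-sound (wt 5) (wt 5) Z U z≤ (normal-⊑ {U} norm) h)
      ... | inj₂ h with T-or {splitTest (wt 6) (wt 4) zs (upper 2 2 1) (cross Z U)} h
      ...   | inj₁ h = inj₂ (inj₁ (light , splitTest-sound (wt 6) (wt 4) Z U z≤ (normal-⊑ {U} norm) h))
      ...   | inj₂ h = inj₂ (inj₂ (≤ᵇ⇒≤ (total (cross Z U)) _ h))
    ... | inj₂ full = upper 2 2 2 , six-shape U full , go X x≤ px , go Y y≤ py
      where
      go : ∀ {zs} Z → zs ⊑ Z → Profile zs → Outcome zs (upper 2 2 2) Z U
      go {zs} Z z≤ (_ , check , _) with T-or (apply-check check Z U)
      ... | inj₁ h = inj₁ (splitTest-sound (wt 5) (wt 5) Z U z≤ (six-shape U full) h)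
      ... | inj₂ h = inj₂ (inj₂ (≤ᵇ⇒≤ (total (cross Z U)) _ h))

  weights≤ : ∀ ts → sum (map w ts) ≤ 6 * length ts
  weights≤ []       = z≤n
  weights≤ (t ∷ ts) = subst (w t + sum (map w ts) ≤_) (≡-sym (*-suc 6 (length ts)))
    (+-mono-≤ (w≤6 t) (weights≤ ts))

  E-join : ∀ X Y U → E (verts X ++ verts Y) U ≡ total (cross X U) + total (cross Y U)
  E-join (x , y , z) (x′ , y′ , z′) U = arith (d x U) (d y U) (d z U) (d x′ U) (d y′ U) (d z′ U)
    where
    arith : ∀ a b c e f g → a + (b + (c + (e + (f + (g + 0))))) ≡ a + b + c + (e + f + g)
    arith = solve-∀

  total-self : ∀ X → w X ≤ 4 → total (cross X X) ≤ 8
  total-self X h = ≤-trans (≤-reflexive (≡-trans (≡-sym (total-E X X)) (inner _ _ _))) (*-monoʳ-≤ 2 h)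

  two-fives-good : ∀ {X Y U} ts → TwoFives X Y U → flat (X ∷ Y ∷ U ∷ ts) ↭ L → All Five ts → Good
  two-fives-good ts (A , B , C , e , a , b) perm fs = good-one-deficient C (A ∷ B ∷ ts)
    (↭-trans (flat-↭ (↭-sym (shift C (A ∷ B ∷ []) ts))) (↭-trans (++⁺ʳ (flat ts) e) perm)) (a ∷ b ∷ fs)

  opaque
    -- Each of X and Y takes at most 8 + 12 edges, and 6 + 40 < 48.
    deficient-pair : ∀ X Y ts → flat (X ∷ Y ∷ ts) ↭ L → All Five ts →
      w X ≤ 4 → w Y ≤ 4 → total (cross X Y) ≤ 12 →
      ∃₂ λ U rest → (flat (X ∷ Y ∷ U ∷ rest) ↭ L) × Normal U × All Five rest ×
        24 < total (cross X U) + total (cross Y U) ×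
        length ts ≡ suc (length rest) × sum (map w ts) ≡ w U + sum (map w rest)
    deficient-pair X Y ts perm fs hX hY hXY
      with heavy-weighted (verts X ++ verts Y) (X ∷ Y ∷ []) ts perm fs
        (s≤s (≤-trans (+-monoʳ-≤ 6 (+-mono-≤
          (≤-trans (≤-reflexive (E-join X Y X)) (+-mono-≤ (total-self X hX) (≤-trans (≤-reflexive (total-sym Y X)) hXY)))
          (+-monoˡ-≤ 0 (≤-trans (≤-reflexive (E-join X Y Y)) (+-mono-≤ hXY (total-self Y hY)))))) (n≤1+n 46)))
    ... | U , rest , perm′ , norm , fs′ , big , eqs =
      U , rest , perm′ , norm , fs′ , subst (24 <_) (E-join X Y U) big , eqs

  opaque
    -- Induction on `N`, which bounds how much the tiles of `ts` together fall short of weight 6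
    -- each. An improvement replaces a tile of weight at most 5 by a 6-triangle and so lowers this
    -- deficit.
    good-two-deficient : ∀ N X Y ts → flat (X ∷ Y ∷ ts) ↭ L → All Five ts → 4 ≤ w X → 4 ≤ w Y →
      6 * length ts ≤ N + sum (map w ts) → Good

    two-deficient-profiled : ∀ N {xs ys} X Y ts → flat (X ∷ Y ∷ ts) ↭ L → All Five ts → 4 ≤ w X → 4 ≤ w Y →
      6 * length ts ≤ N + sum (map w ts) → xs ⊑ X → Profile xs → ys ⊑ Y → Profile ys → Good

    improve : ∀ N Z Z′ U rest {ts} → flat (Z ∷ Z′ ∷ U ∷ rest) ↭ L → All Five rest → 4 ≤ w Z′ →
      6 * length ts ≤ N + sum (map w ts) →
      length ts ≡ suc (length rest) → sum (map w ts) ≡ w U + sum (map w rest) → Improves Z U → Good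

    good-two-deficient N X Y ts perm fs hX hY fuel =
      let U , e , hU , xs , x≤ , px = four-profile X hX
          W , f , hW , ys , y≤ , py = four-profile Y hY
      in two-deficient-profiled N U W ts (↭-trans (++⁺ e (++⁺ʳ (flat ts) f)) perm) fs hU hW fuel x≤ px y≤ py

    two-deficient-profiled N {xs} {ys} X Y ts perm fs hX hY fuel x≤ px y≤ py
      with split-≤ (w X) 4 | split-≤ (w Y) 4 | split-≤ (total (cross X Y)) 12
    ... | inj₂ fX | _ | _ = good-one-deficient Y (X ∷ ts) (↭-trans (swap-tiles {Y} {X} ts) perm) (fX ∷ fs)
    ... | inj₁ _ | inj₂ fY | _ = good-one-deficient X (Y ∷ ts) perm (fY ∷ fs)
    ... | inj₁ _ | inj₁ _ | inj₂ big =
      let A , B , e , a , _ = splitTest-sound (wt 5) (wt 0) X Y (upper-⊑ z≤n z≤n z≤n) y≤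
                                (check≤ {total (cross X Y)} 12 (apply-check (proj₂ (proj₂ py)) X Y) big)
      in good-one-deficient B (A ∷ ts) (↭-trans (swap-tiles {B} {A} ts) (regroup {A} {B} {X} {Y} ts e perm)) (a ∷ fs)
    ... | inj₁ wX | inj₁ wY | inj₁ wXY with deficient-pair X Y ts perm fs wX wY wXY
    ...   | U , rest , perm′ , norm , fs′ , big , len , wts with outcomes X Y U x≤ px y≤ py norm
    ...     | _ , t≤ , inj₁ (A , B , e , a , b) , _ = good-one-deficient Y (A ∷ B ∷ rest)
              (↭-trans (++⁺ˡ (verts Y) (++⁺ʳ (flat rest) e)) (↭-trans (swap-tiles {Y} {X} (U ∷ rest)) perm′)) (a ∷ b ∷ fs′)
    ...     | _ , t≤ , _ , inj₁ (A , B , e , a , b) = good-one-deficient X (A ∷ B ∷ rest)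
              (↭-trans (++⁺ˡ (verts X) (++⁺ʳ (flat rest) e)) perm′) (a ∷ b ∷ fs′)
    ...     | _ , t≤ , inj₂ (inj₁ imp) , _ = improve N X Y U rest {ts} perm′ fs′ hY fuel len wts imp
    ...     | _ , t≤ , _ , inj₂ (inj₁ imp) = improve N Y X U rest {ts}
              (↭-trans (swap-tiles {Y} {X} (U ∷ rest)) perm′) fs′ hX fuel len wts imp
    ...     | _ , t≤ , inj₂ (inj₂ cX) , inj₂ (inj₂ cY) =
              two-fives-good rest (codes-sound X Y U x≤ y≤ t≤ cX cY big) perm′ fs′

    improve N Z Z′ U rest {ts} perm fs hZ′ fuel len wts (light , A , B , e , a , b) = continue N fuel
      where
      perm′ : flat (B ∷ Z′ ∷ A ∷ rest) ↭ L
      perm′ = ↭-trans (flat-↭ {us = A ∷ B ∷ Z′ ∷ rest} (↭-trans (↭-prep B (↭-swap Z′ A ↭-refl))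
                              (↭-trans (↭-swap B A ↭-refl) (↭-prep A (↭-prep B ↭-refl)))))
              (regroup {A} {B} {Z} {U} (Z′ ∷ rest) e
                (↭-trans (++⁺ˡ (verts Z) (swap-tiles {U} {Z′} rest)) perm))
      better : suc (sum (map w ts)) ≤ w A + sum (map w rest)
      better = ≤-trans (≤-reflexive (cong suc wts)) (+-monoˡ-≤ (sum (map w rest)) (≤-trans (s≤s light) a))
      continue : ∀ N → 6 * length ts ≤ N + sum (map w ts) → Good
      -- Without any deficit, the gain from `A` would push the total above 6 per tile.
      continue zero fuel = ≰-elim (≤-trans better (≤-trans (weights≤ (A ∷ rest))
        (≤-reflexive (cong (6 *_) (≡-sym len))))) (s≤s fuel)
      continue (suc N) fuel = good-two-deficient N B Z′ (A ∷ rest) perm′ (≤-trans (n≤1+n 5) a ∷ fs) b hZ′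
        (≤-trans (≤-reflexive (cong (6 *_) (≡-sym len))) (≤-trans fuel
          (≤-trans (≤-reflexive (≡-sym (+-suc N (sum (map w ts))))) (+-monoʳ-≤ N better))))

-- Tiles through a given vertex

Unique-resp-↭ : ∀ {A : Set} {xs ys : List A} → xs ↭ ys → Unique xs → Unique ys
Unique-resp-↭ {A} p = Permutationₛ.Unique-resp-↭ (setoid A) (↭⇒↭ₛ p)

drop-head : ∀ {A : Set} (T : Triple A) ts → Unique (flat (T ∷ ts)) → Unique (flat ts)
drop-head T ts (_ ∷ _ ∷ _ ∷ u) = u

Avoids : ∀ {A : Set} → A → Triple A → Set
Avoids x T = All (x ≢_) (verts T)

avoids? : ∀ {n} (x : Fin n) T → Dec (Avoids x T)
avoids? x T = all? (λ y → ¬? (x Fin.≟ y)) (verts T)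

all-flat : ∀ {A : Set} {P : A → Set} ts → All P (flat ts) → All (All P ∘ verts) ts
all-flat []       []               = []
all-flat (T ∷ ts) (p ∷ q ∷ r ∷ ps) = (p ∷ q ∷ r ∷ []) ∷ all-flat ts ps

others-avoid : ∀ {n} (x : Fin n) T ts → Unique (flat (T ∷ ts)) → ¬ Avoids x T → All (Avoids x) ts
others-avoid x T@(a , b , c) ts ((_ ∷ _ ∷ A) ∷ (_ ∷ B) ∷ C ∷ _) ¬avoid
  with x Fin.≟ a | x Fin.≟ b | x Fin.≟ c
... | yes refl | _ | _ = all-flat ts A
... | no _ | yes refl | _ = all-flat ts B
... | no _ | no _ | yes refl = all-flat ts C
... | no p | no q | no r = contradiction (p ∷ q ∷ r ∷ []) ¬avoid

-- If no tile contains `x`, the last one is singled out, so a remainder avoiding `x` always exists.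
separate : ∀ {n} (x : Fin n) T ts → Unique (flat (T ∷ ts)) →
  ∃₂ λ U us → (T ∷ ts ↭ U ∷ us) × All (Avoids x) us
separate x T []       u = T , [] , ↭-refl , []
separate x T (S ∷ ts) u with avoids? x T
... | no ¬a = T , S ∷ ts , ↭-refl , others-avoid x T (S ∷ ts) u ¬a
... | yes a with separate x S ts (drop-head T (S ∷ ts) u)
...   | U , us , p , as = U , T ∷ us , ↭-trans (↭-prep T p) (↭-swap T U ↭-refl) , a ∷ as

-- Raising one multiplicity

module Bump {n} (M : Multigraph n) (std : Standard M) {x y : Fin n} (x≢y : x ≢ y) where

  Ends : Fin n → Fin n → Set
  Ends a b = (a ≡ x × b ≡ y) ⊎ (a ≡ y × b ≡ x)

  ends? : ∀ a b → Dec (Ends a b)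
  ends? a b = (a Fin.≟ x ×-dec b Fin.≟ y) ⊎-dec (a Fin.≟ y ×-dec b Fin.≟ x)

  ends-sym : ∀ {a b} → Ends a b → Ends b a
  ends-sym (inj₁ (p , q)) = inj₂ (q , p)
  ends-sym (inj₂ (p , q)) = inj₁ (q , p)

  ends-functional : ∀ {a b c} → Ends a b → Ends a c → b ≡ c
  ends-functional (inj₁ (_ , refl)) (inj₁ (_ , refl)) = refl
  ends-functional (inj₁ (p , _))    (inj₂ (q , _))    = contradiction (≡-trans (≡-sym p) q) x≢y
  ends-functional (inj₂ (p , _))    (inj₁ (q , _))    = contradiction (≡-trans (≡-sym q) p) x≢y
  ends-functional (inj₂ (_ , refl)) (inj₂ (_ , refl)) = refl

  -- The cap at 2 keeps the multigraph standard; a pair that is already double does not change.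
  bumped : Fin n → Fin n → ℕ
  bumped a b with ends? a b
  ... | yes _ = 2 ⊓ suc (μ M a b)
  ... | no _  = μ M a b

  bumped-sym : ∀ a b → bumped a b ≡ bumped b a
  bumped-sym a b with ends? a b | ends? b a
  ... | yes _ | yes _ = cong (λ k → 2 ⊓ suc k) (μ-sym M a b)
  ... | no _  | no _  = μ-sym M a b
  ... | yes p | no ¬q = contradiction (ends-sym p) ¬q
  ... | no ¬p | yes q = contradiction (ends-sym q) ¬p

  bumped-loopless : ∀ a → bumped a a ≡ 0
  bumped-loopless a with ends? a a
  ... | yes (inj₁ (p , q)) = contradiction (≡-trans (≡-sym p) q) x≢y
  ... | yes (inj₂ (p , q)) = contradiction (≡-trans (≡-sym q) p) x≢y
  ... | no _  = loopless M a

  bump : Multigraph n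
  bump = record { μ = bumped ; sym = bumped-sym ; loopless = bumped-loopless }

  bump-standard : Standard bump
  bump-standard a b with ends? a b
  ... | yes _ = m⊓n≤m 2 _
  ... | no _  = std a b

  bump-≥ : ∀ a b → μ M a b ≤ bumped a b
  bump-≥ a b with ends? a b
  ... | yes _ = ⊓-glb (std a b) (n≤1+n _)
  ... | no _  = ≤-refl

  bump-ends : 2 ⊓ suc (μ M x y) ≤ bumped x y
  bump-ends with ends? x y
  ... | yes _ = ≤-refl
  ... | no ¬e = contradiction (inj₁ (refl , refl)) ¬e

  bump-off : ∀ {a b} → ¬ Ends a b → bumped a b ≡ μ M a b
  bump-off {a} {b} ¬e with ends? a b
  ... | yes e = contradiction e ¬e
  ... | no _  = refl

  bump-away : ∀ {a b} → x ≢ a → x ≢ b → bumped a b ≡ μ M a b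
  bump-away x≢a x≢b = bump-off λ
    { (inj₁ (p , _)) → x≢a (≡-sym p) ; (inj₂ (_ , p)) → x≢b (≡-sym p) }

  open Weights M std
  module W′ = Weights bump bump-standard

  w-away : ∀ T → Avoids x T → W′.w T ≡ w T
  w-away T (p ∷ q ∷ r ∷ []) = cong₂ _+_ (cong₂ _+_ (bump-away p q) (bump-away q r)) (bump-away p r)

  tri-away : ∀ {k} T → Avoids x T → W′.⟦ tri k ⟧ T → ⟦ tri k ⟧ T
  tri-away {k} T av@(p ∷ q ∷ r ∷ []) (f , g , h , s) =
    subst (1 ≤_) (bump-away p q) f , subst (1 ≤_) (bump-away q r) g ,
    subst (1 ≤_) (bump-away p r) h , subst (k ≤_) (w-away T av) s

  fives-away : ∀ {ts} → All (Avoids x) ts → All W′.Five ts → All Five ts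
  fives-away []               []       = []
  fives-away (_∷_ {T} av avs) (f ∷ fs) = subst (5 ≤_) (w-away T av) f ∷ fives-away avs fs

  -- The vertices are distinct, so at most one of the three pairs is the raised one.
  w-bump : ∀ T → Unique (verts T) → W′.w T ≤ suc (w T)
  w-bump (a , b , c) ((a≢b ∷ a≢c ∷ []) ∷ (b≢c ∷ []) ∷ _) with ends? a b | ends? b c | ends? a c
  ... | no _ | no _ | no _ = n≤1+n _
  ... | yes _ | no _ | no _ = +-monoˡ-≤ (m a c) (+-monoˡ-≤ (m b c) (m⊓n≤n 2 _))
  ... | no _ | yes _ | no _ = ≤-trans (+-monoˡ-≤ (m a c) (+-monoʳ-≤ (m a b) (m⊓n≤n 2 _)))
                               (≤-reflexive (cong (_+ m a c) (+-suc (m a b) (m b c))))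
  ... | no _ | no _ | yes _ = ≤-trans (+-monoʳ-≤ (m a b + m b c) (m⊓n≤n 2 _))
                               (≤-reflexive (+-suc (m a b + m b c) (m a c)))
  ... | yes p | yes q | _ = contradiction (ends-functional (ends-sym p) q) a≢c
  ... | yes p | _ | yes r = contradiction (ends-functional p r) b≢c
  ... | _ | yes q | yes r = contradiction (ends-functional (ends-sym q) (ends-sym r)) (≢-sym a≢b)

head-unique : ∀ {A : Set} (T : Triple A) ts → Unique (flat (T ∷ ts)) → Unique (verts T)
head-unique T ts ((p ∷ q ∷ _) ∷ (r ∷ _) ∷ _) = (p ∷ q ∷ []) ∷ (r ∷ []) ∷ [] ∷ []

sum-map-mono : ∀ {A : Set} {f g : A → ℕ} → (∀ a → f a ≤ g a) → ∀ xs → sum (map f xs) ≤ sum (map g xs)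
sum-map-mono h []       = z≤n
sum-map-mono h (x ∷ xs) = +-mono-≤ (h x) (sum-map-mono h xs)

-- Saturating a partition and removing the edges again

module Saturation {n} (ts₀ : List (Triple (Fin n))) (u₀ : Unique (flat ts₀)) where

  Dense : Multigraph n → Set
  Dense M = ∀ x → 4 * length ts₀ ≤ suc (sum (map (μ M x) (flat ts₀)))

  dense-mono : ∀ {M N} → (∀ a b → μ M a b ≤ μ N a b) → Dense M → Dense N
  dense-mono h deg x = ≤-trans (deg x) (s≤s (sum-map-mono (h x) (flat ts₀)))

  module C M (std : Standard M) (deg : Dense M) =
    Core M std (flat ts₀) (length ts₀) (length-flat ts₀) deg

  module _ (M : Multigraph n) (std : Standard M) (deg : Dense M) {x y : Fin n} (x≢y : x ≢ y) where
    open Bump M std x≢y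

    -- Only a tile containing x can lose weight, and it loses at most one. If it is the 4-triangle,
    -- that tile keeps weight 3 and all others are intact. Otherwise the 4-triangle is intact and at
    -- most one 5-triangle drops to weight 4.
    unbump : C.Good bump bump-standard (dense-mono {M} {bump} bump-≥ deg) → C.Good M std deg
    unbump (t , ts , perm , tri₄ , fs) = by (avoids? x t)
      where
      open Weights M std
      u : Unique (flat (t ∷ ts))
      u = Unique-resp-↭ (↭-sym perm) u₀
      by : Dec (Avoids x t) → C.Good M std deg
      by (no ¬a) = C.good-three M std deg t ts perm (fives-away (others-avoid x t ts u ¬a) fs)
        (s≤s⁻¹ (≤-trans (proj₂ (proj₂ (proj₂ tri₄))) (w-bump t (head-unique t ts u))))
      by (yes a) = rest ts refl
        where
        rest : ∀ us → ts ≡ us → C.Good M std deg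
        rest []       refl = t , [] , perm , tri-away t a tri₄ , []
        rest (s ∷ ss) refl with separate x s ss (drop-head t (s ∷ ss) u)
        ... | U , us , p , as with All-resp-↭ p fs
        -- The value `6 * length us` bounds any possible deficit.
        ...   | f ∷ fs′ = C.good-two-deficient M std deg (6 * length us) t U us
                (↭-trans (flat-↭ (↭-prep t (↭-sym p))) perm)
                (fives-away as fs′)
                (proj₂ (proj₂ (proj₂ (tri-away t a tri₄))))
                (s≤s⁻¹ (≤-trans f (w-bump U (head-unique U us
                  (Unique-resp-↭ (flat-↭ p) (drop-head t (s ∷ ss) u))))))
                (m≤m+n _ _)

  Solvable : Multigraph n → Set
  Solvable M = (std : Standard M) (deg : Dense M) → C.Good M std deg

  _⊆_ : Multigraph n → Multigraph n → Set
  M ⊆ N = ∀ a b → μ M a b ≤ μ N a b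

  Full : Multigraph n → Triple (Fin n) → Set
  Full N (a , b , c) = 2 ≤ μ N a b × 2 ≤ μ N b c × 2 ≤ μ N a c

  -- Raising twice reaches multiplicity 2 from any start. The continuation covers every N above M,
  -- so that pairs made double earlier stay double.
  saturate-edge : ∀ M {x y} → x ≢ y → (∀ N → M ⊆ N → 2 ≤ μ N x y → Solvable N) → Solvable M
  saturate-edge M {x} {y} x≢y solve std deg =
    unbump M std deg x≢y (unbump M′ std′ deg′ x≢y
      (solve N (λ a b → ≤-trans (B.bump-≥ a b) (B′.bump-≥ a b))
        (≤-trans (⊓-glb ≤-refl (s≤s (≤-trans (⊓-glb (s≤s z≤n) (s≤s z≤n)) B.bump-ends))) B′.bump-ends)
        B′.bump-standard (dense-mono {M′} {N} B′.bump-≥ deg′)))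
    where
    module B = Bump M std x≢y
    M′ : Multigraph n
    M′ = B.bump
    std′ : Standard M′
    std′ = B.bump-standard
    deg′ : Dense M′
    deg′ = dense-mono {M} {M′} B.bump-≥ deg
    module B′ = Bump M′ std′ x≢y
    N : Multigraph n
    N = B′.bump

  saturate : ∀ ts → All (λ T → Unique (verts T)) ts → ∀ M →
    (∀ N → M ⊆ N → All (Full N) ts → Solvable N) → Solvable M
  saturate []       []       M solve = solve M (λ _ _ → ≤-refl) []
  saturate (T@(a , b , c) ∷ ts) (((a≢b ∷ a≢c ∷ []) ∷ (b≢c ∷ []) ∷ _) ∷ us) M solve =
    saturate-edge M a≢b λ N₁ M⊆N₁ ab → saturate-edge N₁ b≢c λ N₂ N₁⊆N₂ bc →
    saturate-edge N₂ a≢c λ N₃ N₂⊆N₃ ac → saturate ts us N₃ λ N N₃⊆N full →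
    solve N (λ p q → ≤-trans (M⊆N₁ p q) (≤-trans (N₁⊆N₂ p q) (≤-trans (N₂⊆N₃ p q) (N₃⊆N p q))))
      ((≤-trans ab (≤-trans (N₁⊆N₂ a b) (≤-trans (N₂⊆N₃ a b) (N₃⊆N a b))) ,
        ≤-trans bc (≤-trans (N₂⊆N₃ b c) (N₃⊆N b c)) , ≤-trans ac (N₃⊆N a c)) ∷ full)

-- Packings when 3 divides n

tiles-unique : ∀ {A : Set} (ts : List (Triple A)) → Unique (flat ts) → All (λ T → Unique (verts T)) ts
tiles-unique []       _ = []
tiles-unique (T ∷ ts) u = head-unique T ts u ∷ tiles-unique ts (drop-head T ts u)

HasK : ∀ {n} → Multigraph n → ℕ → Triple (Fin n) → Set
HasK M k (x , y , z) = HasKTriangle M k x y z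

-- Two of the pairs contribute at most 4, so the third contributes at least 1.
five-tri : ∀ {n} (M : Multigraph n) (std : Standard M) T → Weights.Five M std T → HasK M 5 T
five-tri M std (a , b , c) h =
  +-cancelʳ-≤ 4 1 (m a b) (≤-trans h (≤-trans (≤-reflexive (+-assoc (m a b) (m b c) (m a c)))
    (+-monoʳ-≤ (m a b) (+-mono-≤ (std b c) (std a c))))) ,
  +-cancelʳ-≤ 4 1 (m b c) (≤-trans h (≤-trans (+-mono-≤ (+-monoˡ-≤ (m b c) (std a b)) (std a c))
    (≤-reflexive (arith (m b c))))) ,
  +-cancelˡ-≤ 4 1 (m a c) (≤-trans h (+-monoˡ-≤ (m a c) (+-mono-≤ (std a b) (std b c)))) , h
  where
  m = μ M
  arith : ∀ q → 2 + q + 2 ≡ q + 4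
  arith = solve-∀

weaken : ∀ {n} (M : Multigraph n) T → HasK M 5 T → HasK M 4 T
weaken M T (p , q , r , s) = p , q , r , ≤-trans (n≤1+n 4) s

Packing : ∀ {n} → Multigraph n → ℕ → Set
Packing M k = ∃₂ λ t ts → suc (length ts) ≡ k × Unique (flat (t ∷ ts)) × HasK M 4 t × All (HasK M 5) ts

solve-tiled : ∀ {n} (M : Multigraph n) → Standard M → ∀ ts → Unique (flat ts) → 1 ≤ length ts →
  (∀ x → 4 * length ts ≤ suc (sum (map (μ M x) (flat ts)))) → Packing M (length ts)
solve-tiled M std ts₀@(t ∷ ts) u _ deg
  with Saturation.saturate ts₀ u ts₀ (tiles-unique ts₀ u) M
    -- In the saturated multigraph the partition `ts₀` is itself a good tiling.
    (λ { N _ ((ab , bc , ac) ∷ full) std′ deg′ → t , ts , ↭-refl ,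
           (≤-trans (s≤s z≤n) ab , ≤-trans (s≤s z≤n) bc , ≤-trans (s≤s z≤n) ac ,
            ≤-trans (m≤m+n 4 2) (+-mono-≤ (+-mono-≤ ab bc) ac)) ,
           All.map (λ { (ab , bc , ac) → ≤-trans (n≤1+n 5) (+-mono-≤ (+-mono-≤ ab bc) ac) }) full })
    std deg
... | t′ , ts′ , p , tri₄ , fs =
  t′ , ts′ ,
  *-cancelˡ-≡ (suc (length ts′)) (length ts₀) 3
    (≡-trans (≡-sym (length-flat (t′ ∷ ts′))) (≡-trans (↭-length p) (length-flat ts₀))) ,
  Unique-resp-↭ (↭-sym p) u , tri₄ , All.map (λ {T} → five-tri M std T) fs

chunk : ∀ {A : Set} k (xs : List A) → length xs ≡ k * 3 → ∃ λ ts → flat ts ≡ xs × length ts ≡ k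
chunk zero    []               _ = [] , refl , refl
chunk (suc k) (a ∷ b ∷ c ∷ xs) h with chunk k xs (suc-injective (suc-injective (suc-injective h)))
... | ts , p , q = (a , b , c) ∷ ts , cong (λ xs → a ∷ b ∷ c ∷ xs) p , cong suc q

∑-tabulate : ∀ n f → ∑ n f ≡ sum (tabulate f)
∑-tabulate zero    f = refl
∑-tabulate (suc n) f = cong (f zero +_) (∑-tabulate n (f ∘ suc))

deg-allFin : ∀ {n} (M : Multigraph n) x → deg M x ≡ sum (map (μ M x) (allFin n))
deg-allFin {n} M x = ≡-trans (∑-tabulate n (μ M x)) (cong sum (≡-sym (map-tabulate (λ i → i) (μ M x))))

packing-divisible : ∀ {n} k (M : Multigraph n) → Standard M → n ≡ k * 3 → 1 ≤ k →
  (∀ x → 4 * k ≤ suc (deg M x)) → Packing M k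
packing-divisible {n} k M std n≡ 1≤k deg′ with chunk k (allFin n) (≡-trans (length-tabulate (λ i → i)) n≡)
... | ts , p , refl = solve-tiled M std ts (subst Unique (≡-sym p) (Unique.allFin⁺ n)) 1≤k
  λ x → ≤-trans (deg′ x) (s≤s (≤-reflexive (≡-trans (deg-allFin M x) (cong (sum ∘ map (μ M x)) (≡-sym p)))))

-- Deleting a vertex and adding an apex

map₃ : ∀ {A B : Set} → (A → B) → Triple A → Triple B
map₃ f (a , b , c) = f a , f b , f c

flat-map : ∀ {A B : Set} (f : A → B) ts → flat (map (map₃ f) ts) ≡ map f (flat ts)
flat-map f []       = refl
flat-map f (T ∷ ts) = cong (map f (verts T) ++_) (flat-map f ts)

delete : ∀ {n} → Multigraph (suc n) → Multigraph n
delete M = record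
  { μ = λ x y → μ M (suc x) (suc y) ; sym = λ x y → μ-sym M (suc x) (suc y) ; loopless = loopless M ∘ suc }

undelete : ∀ {n k} (M : Multigraph (suc n)) → Packing (delete M) k → Packing M k
undelete M (t , ts , len , u , tri₄ , tri₅) =
  map₃ suc t , map (map₃ suc) ts , ≡-trans (cong suc (length-map (map₃ suc) ts)) len ,
  subst Unique (≡-sym (flat-map suc (t ∷ ts))) (Unique.map⁺ Fin.suc-injective u) , tri₄ , All.map⁺ tri₅

coned : ∀ {n} → Multigraph n → Fin (suc n) → Fin (suc n) → ℕ
coned M zero    zero    = 0
coned M zero    (suc y) = 2
coned M (suc x) zero    = 2
coned M (suc x) (suc y) = μ M x y

cone : ∀ {n} → Multigraph n → Multigraph (suc n)
cone M = record
  { μ = coned M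
  ; sym = λ { zero zero → refl ; zero (suc _) → refl ; (suc _) zero → refl ; (suc x) (suc y) → μ-sym M x y }
  ; loopless = λ { zero → refl ; (suc x) → loopless M x } }

cone-standard : ∀ {n} (M : Multigraph n) → Standard M → Standard (cone M)
cone-standard M std zero    zero    = z≤n
cone-standard M std zero    (suc y) = ≤-refl
cone-standard M std (suc x) zero    = ≤-refl
cone-standard M std (suc x) (suc y) = std x y

∑-const : ∀ n c → ∑ n (λ _ → c) ≡ n * c
∑-const zero    c = refl
∑-const (suc n) c = cong (c +_) (∑-const n c)

lower : ∀ {n} (ts : List (Triple (Fin (suc n)))) → All (Avoids zero) ts → ∃ λ us → ts ≡ map (map₃ suc) us
lower []                              []                    = [] , refl
lower ((zero , _ , _) ∷ _)            ((z ∷ _) ∷ _)         = contradiction refl z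
lower ((suc _ , zero , _) ∷ _)        ((_ ∷ z ∷ _) ∷ _)     = contradiction refl z
lower ((suc _ , suc _ , zero) ∷ _)    ((_ ∷ _ ∷ z ∷ _) ∷ _) = contradiction refl z
lower ((suc a , suc b , suc c) ∷ ts)  (_ ∷ av)              =
  let us , e = lower ts av in (a , b , c) ∷ us , cong (_ ∷_) e

lower-packing : ∀ {n} (M : Multigraph n) k t ts → suc (length ts) ≡ k → Unique (flat (t ∷ ts)) →
  HasK (cone M) 4 t → All (HasK (cone M) 5) ts → All (Avoids zero) (t ∷ ts) → Packing M k
lower-packing M k t ts len u tri₄ tri₅ av with lower (t ∷ ts) av
... | s ∷ ss , refl =
  s , ss , ≡-trans (cong suc (≡-sym (length-map (map₃ suc) ss))) len ,
  Unique.map⁻ (subst Unique (flat-map suc (s ∷ ss)) u) , tri₄ , All.map⁻ tri₅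

-- The tile at the apex is discarded. If it is the 4-triangle, a 5-triangle takes over its role;
-- `1 ≤ k` supplies one.
uncone : ∀ {n k} (M : Multigraph n) → 1 ≤ k → Packing (cone M) (suc k) → Packing M k
uncone M 1≤k (t , [] , refl , _) = contradiction 1≤k λ ()
uncone {k = k} M 1≤k (t , s ∷ ss , refl , u , tri₄ , f ∷ fs) with avoids? zero t
... | no ¬a = lower-packing M k s ss refl (drop-head t (s ∷ ss) u) (weaken (cone M) s f) fs
                (others-avoid zero t (s ∷ ss) u ¬a)
... | yes a with separate zero s ss (drop-head t (s ∷ ss) u)
...   | U , us , p , as with All-resp-↭ p (f ∷ fs)
...     | _ ∷ fs′ = lower-packing M k t us (≡-sym (↭-length p))
            (drop-head U (t ∷ us) (Unique-resp-↭
              (flat-↭ {us = U ∷ t ∷ us} (↭-trans (↭-prep t p) (↭-swap t U ↭-refl))) u))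
            tri₄ fs′ (a ∷ as)

-- From packings to indexed tilings

at-flat : ∀ {A : Set} {P : A → Set} ts → All P (flat ts) → ∀ i j → P (at (lookup ts i) j)
at-flat (T ∷ ts) (p ∷ _ ∷ _ ∷ _)  zero    0F = p
at-flat (T ∷ ts) (_ ∷ p ∷ _ ∷ _)  zero    1F = p
at-flat (T ∷ ts) (_ ∷ _ ∷ p ∷ _)  zero    2F = p
at-flat (T ∷ ts) (_ ∷ _ ∷ _ ∷ ps) (suc i) j  = at-flat ts ps i j

at-injective : ∀ {A : Set} (T : Triple A) → Unique (verts T) → ∀ j j′ → at T j ≡ at T j′ → j ≡ j′
at-injective T u 0F 0F _ = refl
at-injective T u 1F 1F _ = refl
at-injective T u 2F 2F _ = refl
at-injective T ((p ∷ _) ∷ _)         0F 1F e = contradiction e p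
at-injective T ((_ ∷ p ∷ _) ∷ _)     0F 2F e = contradiction e p
at-injective T (_ ∷ (p ∷ _) ∷ _)     1F 2F e = contradiction e p
at-injective T ((p ∷ _) ∷ _)         1F 0F e = contradiction (≡-sym e) p
at-injective T ((_ ∷ p ∷ _) ∷ _)     2F 0F e = contradiction (≡-sym e) p
at-injective T (_ ∷ (p ∷ _) ∷ _)     2F 1F e = contradiction (≡-sym e) p

at-fresh : ∀ {A : Set} (T : Triple A) ts → Unique (flat (T ∷ ts)) → ∀ j i′ j′ → at T j ≢ at (lookup ts i′) j′
at-fresh T ts ((_ ∷ _ ∷ p) ∷ _)     0F i′ j′ = at-flat ts p i′ j′
at-fresh T ts (_ ∷ (_ ∷ p) ∷ _)     1F i′ j′ = at-flat ts p i′ j′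
at-fresh T ts (_ ∷ _ ∷ p ∷ _)       2F i′ j′ = at-flat ts p i′ j′

lookup-at-injective : ∀ {A : Set} (ts : List (Triple A)) → Unique (flat ts) → ∀ i j i′ j′ →
  at (lookup ts i) j ≡ at (lookup ts i′) j′ → i ≡ i′ × j ≡ j′
lookup-at-injective (T ∷ ts) u zero    j zero     j′ e = refl , at-injective T (head-unique T ts u) j j′ e
lookup-at-injective (T ∷ ts) u zero    j (suc i′) j′ e = contradiction e (at-fresh T ts u j i′ j′)
lookup-at-injective (T ∷ ts) u (suc i) j zero     j′ e = contradiction (≡-sym e) (at-fresh T ts u j′ i j)
lookup-at-injective (T ∷ ts) u (suc i) j (suc i′) j′ e =
  let p , q = lookup-at-injective ts (drop-head T ts u) i j i′ j′ e in cong suc p , q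

packing⇒tiling : ∀ {n k} (M : Multigraph n) → Packing M k →
  Σ (TriangleTiling M k) λ T → Σ (Fin k) λ i₀ →
    TileIsK T i₀ 4 × (∀ i → ¬ (i ≡ i₀) → TileIsK T i 5)
packing⇒tiling M (t , ts , refl , u , tri₄ , tri₅) =
  record { v = λ i → at (lookup (t ∷ ts) i) ; disjoint = lookup-at-injective (t ∷ ts) u } ,
  zero , tri₄ , λ { zero ne → contradiction refl ne ; (suc i) _ → All.lookup tri₅ (∈-lookup i) }


-- The residues of n modulo 3

pack : ∀ r k {n} (M : Multigraph n) → Standard M → MinDegreeCond M → r < 3 → n ≡ r + k * 3 → 1 ≤ k → Packing M k
pack 0 k M std degs _ refl 1≤k = packing-divisible k M std refl 1≤k λ x →
  *-cancelˡ-≤ 3 (subst₂ _≤_ (a₁ k) (a₂ (deg M x)) (degs x))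
  where
  a₁ : ∀ k → 4 * (k * 3) ≡ 3 * (4 * k)
  a₁ = solve-∀
  a₂ : ∀ d → 3 * d + 3 ≡ 3 * suc d
  a₂ = solve-∀
-- Deletion lowers a degree by at most 2. For the new degree d, 12k + 4 ≤ 3(d + 2) + 3 gives 3 · 4k
-- < 3(d + 2), hence 4k ≤ d + 1.
pack 1 k M std degs _ refl 1≤k = undelete M (packing-divisible k (delete M) (λ x y → std (suc x) (suc y)) refl 1≤k λ x →
  s≤s⁻¹ (*-cancelˡ-< 3 (4 * k) (suc (suc (deg (delete M) x)))
    (+-cancelʳ-≤ 3 _ _ (subst₂ _≤_ (a₁ k) (a₂ (deg (delete M) x))
      (≤-trans (degs (suc x)) (+-monoˡ-≤ 3 (*-monoʳ-≤ 3 (+-monoˡ-≤ (deg (delete M) x) (std (suc x) zero)))))))))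
  where
  a₁ : ∀ k → 4 * suc (k * 3) ≡ suc (3 * (4 * k)) + 3
  a₁ = solve-∀
  a₂ : ∀ d → 3 * (2 + d) + 3 ≡ 3 * suc (suc d) + 3
  a₂ = solve-∀
-- The apex has degree 2(3k + 2). Every other degree d grows by 2, so 4(k + 1) ≤ d + 3 is needed,
-- and d ≥ 4k + 1 suffices.
pack 2 k M std degs _ refl 1≤k = uncone M 1≤k (packing-divisible (suc k) (cone M) (cone-standard M std) refl (s≤s z≤n) λ
  { zero → subst₂ _≤_ (a₁ k) (cong (suc) (≡-sym (∑-const (2 + k * 3) 2))) (≤-trans (m≤m+n (4 * k + 4) (2 * k + 1)) (≤-reflexive (a₂ k)))
  ; (suc x) → ≤-trans (≤-reflexive (a₃ k)) (+-monoʳ-≤ 3 (*-cancelˡ-≤ 3 (+-cancelʳ-≤ 3 _ _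
      (≤-trans (≤-trans (m≤m+n _ 2) (≤-reflexive (a₄ k))) (degs x))))) })
  where
  a₁ : ∀ k → 4 * k + 4 ≡ 4 * suc k
  a₁ = solve-∀
  a₂ : ∀ k → 4 * k + 4 + (2 * k + 1) ≡ suc ((2 + k * 3) * 2)
  a₂ = solve-∀
  a₃ : ∀ k → 4 * suc k ≡ 3 + suc (4 * k)
  a₃ = solve-∀
  a₄ : ∀ k → 3 * suc (4 * k) + 3 + 2 ≡ 4 * (2 + k * 3)
  a₄ = solve-∀
pack (suc (suc (suc _))) k M std degs (s≤s (s≤s (s≤s ()))) _ _

theorem10 : (n : ℕ) → 3 ≤ n → (M : Multigraph n) → Standard M →
    MinDegreeCond M → GoodTiling M
theorem10 n 3≤n M std degs = packing⇒tiling M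
  (pack (n % 3) (n / 3) M std degs (m%n<n n 3) (m≡m%n+[m/n]*n n 3) (m≥n⇒m/n>0 3≤n))
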